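{- For every $n\in\mathbb{N}$, $\tilde{R}(\dot C^{(rbr)}_{2},Q_n)=\tilde{R}(\dot C^{(rbr)}_{3},Q_n)=2n$. For every $t\ge 4$ and sufficiently large $n$, $2.24n< \tilde{R}(\dot C^{(rbr)}_{t},Q_n)\le (t-1)n$.
   Context: $Q_N$ denotes the Boolean lattice of all subsets of an $N$-element set ordered by inclusion. An (induced) copy of a poset $P$ in a poset $Q$ is a subset of $Q$ which, with the inherited order, is isomorphic to $P$. A colored poset $\dot P$ is a poset with a coloring of its elements in blue and red; a copy of $\dot P$ in a colored $Q$ is an induced copy of $P$ whose vertices have the same colors as the corresponding vertices of $\dot P$. $\dot Q_n^{(b)}$ (resp. $\dot Q_n^{(r)}$) is $Q_n$ colored entirely blue (resp. red). $\tilde{R}(\dot P,Q_n)$ is the minimum $N$ such that every blue/red coloring of $Q_N$ contains a copy of $\dot P$, of $\dot Q_n^{(b)}$, or of $\dot Q_n^{(r)}$. The red-alternating chain $\dot C_t^{(rbr)}$ is a chain on $t$ vertices colored alternately red and blue along the chain, with the minimal vertex red. -}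

module Defs where

open import Data.Nat using (ℕ; suc; _<_)
open import Data.Fin using (Fin; toℕ) renaming (_≤_ to _≤ᶠ_)
open import Data.Fin.Subset using (Subset; _⊆_)
open import Data.Product using (Σ; _×_; _,_)
open import Data.Sum using (_⊎_)
open import Relation.Nullary using (¬_)
open import Relation.Binary.PropositionalEquality using (_≡_)

data Colour : Set where
  blue red : Colour

Colouring : ℕ → Set
Colouring N = Subset N → Colour

-- f is an order embedding of a preorder (A, ≤A) into Q_N, i.e. its image is an
-- induced copy of A (injectivity follows from antisymmetry when ≤A is a partial order).
IsEmbedding : {N : ℕ} {A : Set} (_≤A_ : A → A → Set) → (A → Subset N) → Set
IsEmbedding {A = A} _≤A_ f = ∀ (x y : A) → (x ≤A y → f x ⊆ f y) × (f x ⊆ f y → x ≤A y)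

record ColouredPoset : Set₁ where
  field
    Carrier : Set
    _≤_     : Carrier → Carrier → Set
    colour  : Carrier → Colour

HasCopy : {N : ℕ} → ColouredPoset → Colouring N → Set
HasCopy {N} P c =
  Σ (Carrier → Subset N) λ f → IsEmbedding _≤_ f × (∀ x → c (f x) ≡ colour x)
  where open ColouredPoset P

monoQ : ℕ → Colour → ColouredPoset
monoQ n k = record { Carrier = Subset n ; _≤_ = _⊆_ ; colour = λ _ → k }

altColour : ℕ → Colour
altColour 0 = red
altColour 1 = blue
altColour (suc (suc i)) = altColour i

rbrChain : ℕ → ColouredPoset
rbrChain t = record
  { Carrier = Fin t
  ; _≤_ = _≤ᶠ_
  ; colour = λ i → altColour (toℕ i) }

Arrows : ColouredPoset → ℕ → ℕ → Set
Arrows P n N = ∀ (c : Colouring N) →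
  HasCopy P c ⊎ (HasCopy (monoQ n blue) c ⊎ HasCopy (monoQ n red) c)

RamseyEq : ColouredPoset → ℕ → ℕ → Set
RamseyEq P n N = Arrows P n N × (∀ M → M < N → ¬ Arrows P n M)

{-# OPTIONS --safe #-}
module Submission where

-- Upper bound: above the top of an alternating chain found in Q_N there is a copy of Q_n inside Q_{n+N}; either a
-- set in it has the opposite colour and prolongs the chain, or it is monochromatic. For chains of length 3 and
-- N = 2n, a copy of Q_n can be assembled from two blue classes separated by a red one.
--
-- Lower bound 2.24 n: a colouring avoids red < blue < red < blue when it is induced by a monotone map to four
-- levels coloured blue, red, blue, red. Let N = 2n + κ. The lowest level is {|Z| ≤ κ}, the highest {|Z| ≥ β}, and
-- the middle ones are separated by a family 𝓙 of sets of size κ + 1 + ℓ, ℓ ≤ n / 2: the third level consists of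
-- the sets that contain a member of 𝓙. A red copy of Q_n is excluded when 𝓙 has a member J with
-- F ⊆ J ⊆ F ∪ X for all disjoint F, X of sizes κ + 1 and n: it forces the copy into the highest level early. A blue
-- one is excluded when every set of size τ = 2 κ + 1 + ℓ + k contains at most k members of 𝓙. A random family has
-- both properties as soon as 2^τ is exponentially smaller than n C ℓ ≈ 2^n, so for κ < n / 4.

open import Defs
open import Data.Bool using (Bool; true; false; not; if_then_else_)
open import Data.Empty using () renaming (⊥ to Absurd)
open import Data.Fin using (Fin; zero; suc; toℕ; inject≤)
open import Data.Fin.Properties using (any?; all?; suc-injective; toℕ<n; toℕ-inject≤) renaming (_≤?_ to _≤ᶠ?_)
open import Data.Fin.Subset
open import Data.Fin.Subset.Properties
open import Data.List using (List; []; _∷_; length; filter; map; cartesianProduct) renaming (_++_ to _++ᴸ_)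
open import Data.List.Membership.Propositional using (find; lose) renaming (_∈_ to _∈ᴸ_)
open import Data.List.Membership.Propositional.Properties
  using (∈-filter⁺; ∈-filter⁻; ∈-map⁺; ∈-++⁺ˡ; ∈-++⁺ʳ; ∈-cartesianProduct⁺)
open import Data.List.Properties using (length-map; length-++)
import Data.List.Relation.Binary.Sublist.Propositional.Properties as Sublist
open import Data.List.Relation.Unary.All as All using (All; []; _∷_)
open import Data.List.Relation.Unary.Any as Any using (Any; here; there)
open import Data.Nat using (ℕ; zero; suc; _+_; _*_; _∸_; _^_; _/_; _%_; _≤_; _<_; _≥_; z≤n; s≤s; z<s; s<s;
  _≤?_; _<?_; _≟_; NonZero; >-nonZero)
open import Data.Nat.Combinatorics using (_C_; nCk≡nC[n∸k]; nCk+nC[k+1]≡[n+1]C[k+1]; k>n⇒nCk≡0)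
open import Data.Nat.DivMod using (m≡m%n+[m/n]*n; m%n<n; m/n*n≤m; /-monoˡ-≤; m*n/n≡m)
open import Data.Nat.Properties hiding (suc-injective)
open import Data.Nat.Tactic.RingSolver using (solve-∀)
open import Data.Product using (Σ; ∃; _×_; _,_; proj₁; proj₂)
open import Data.Sum using (_⊎_; inj₁; inj₂) renaming (map to ⊎-map; map₁ to ⊎-map₁)
open import Data.Vec using ([]; _∷_; _++_; lookup; tabulate; here; there)
open import Data.Vec.Properties using ([]=⇒lookup; lookup⇒[]=; lookup∘tabulate)
open import Function using (_∘_)
open import Function.Definitions using (Injective)
open import Relation.Binary.Definitions using (DecidableEquality)
open import Relation.Binary.PropositionalEquality
open import Relation.Nullary using (¬_; Dec; yes; no; does; contradiction)
open import Relation.Nullary.Decidable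
  using (_×-dec_; _⊎-dec_; _→-dec_; ¬?; decidable-stable; map′; dec-true; from-yes)
open import Relation.Unary using (Decidable)

-- Subsets and copies of Q_n

∣p∪q∣≡∣p∣+∣q∣ : ∀ {N} (p q : Subset N) → (∀ {x} → x ∈ p → x ∉ q) → ∣ p ∪ q ∣ ≡ ∣ p ∣ + ∣ q ∣
∣p∪q∣≡∣p∣+∣q∣ [] [] disj = refl
∣p∪q∣≡∣p∣+∣q∣ (true  ∷ p) (true  ∷ q) disj = contradiction here (disj here)
∣p∪q∣≡∣p∣+∣q∣ (true  ∷ p) (false ∷ q) disj = cong suc (∣p∪q∣≡∣p∣+∣q∣ p q λ x∈p → disj (there x∈p) ∘ there)
∣p∪q∣≡∣p∣+∣q∣ (false ∷ p) (true  ∷ q) disj =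
  trans (cong suc (∣p∪q∣≡∣p∣+∣q∣ p q λ x∈p → disj (there x∈p) ∘ there)) (sym (+-suc (∣ p ∣) _))
∣p∪q∣≡∣p∣+∣q∣ (false ∷ p) (false ∷ q) disj = ∣p∪q∣≡∣p∣+∣q∣ p q λ x∈p → disj (there x∈p) ∘ there

∪-⊆ : ∀ {N} {p q r : Subset N} → p ⊆ r → q ⊆ r → p ∪ q ⊆ r
∪-⊆ {p = p} {q} p⊆r q⊆r x∈p∪q with x∈p∪q⁻ p q x∈p∪q
... | inj₁ x∈p = p⊆r x∈p
... | inj₂ x∈q = q⊆r x∈q

disjoint⇒∣p∣+∣q∣≤∣r∣ : ∀ {N} {p q r : Subset N} → (∀ {x} → x ∈ p → x ∉ q) →
  p ⊆ r → q ⊆ r → ∣ p ∣ + ∣ q ∣ ≤ ∣ r ∣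
disjoint⇒∣p∣+∣q∣≤∣r∣ {p = p} {q} disj p⊆r q⊆r =
  subst (_≤ _) (∣p∪q∣≡∣p∣+∣q∣ p q disj) (p⊆q⇒∣p∣≤∣q∣ (∪-⊆ p⊆r q⊆r))

∣p∣+∣∁p∣≡n : ∀ {n} (p : Subset n) → ∣ p ∣ + ∣ ∁ p ∣ ≡ n
∣p∣+∣∁p∣≡n p = trans (cong (∣ p ∣ +_) (∣∁p∣≡n∸∣p∣ p)) (m+[n∸m]≡n (∣p∣≤n p))

subsetOfSize : ∀ {N} (p : Subset N) k → k ≤ ∣ p ∣ → ∃ λ q → q ⊆ p × ∣ q ∣ ≡ k
subsetOfSize [] zero z≤n = [] , (λ ()) , refl
subsetOfSize (false ∷ p) k k≤ with subsetOfSize p k k≤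
... | q , q⊆p , ∣q∣≡k = false ∷ q , s⊆s q⊆p , ∣q∣≡k
subsetOfSize {suc N} (true ∷ p) zero _ = ⊥ , ⊆-min _ , ∣⊥∣≡0 (suc N)
subsetOfSize (true ∷ p) (suc k) (s≤s k≤) with subsetOfSize p k k≤
... | q , q⊆p , ∣q∣≡k = true ∷ q , s⊆s q⊆p , cong suc ∣q∣≡k

⊈⇒∃∈∉ : ∀ {N} {p q : Subset N} → p ⊈ q → ∃ λ x → x ∈ p × x ∉ q
⊈⇒∃∈∉ {p = p} {q} p⊈q with any? (λ x → (x ∈? p) ×-dec ¬? (x ∈? q))
... | yes w = w
... | no ¬w = contradiction (λ {x} x∈p → decidable-stable (x ∈? q) λ x∉q → ¬w (x , x∈p , x∉q)) p⊈q

image : ∀ {n N} → (Fin n → Fin N) → Subset n → Subset N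
image x []          = ⊥
image x (true  ∷ S) = ⁅ x zero ⁆ ∪ image (x ∘ suc) S
image x (false ∷ S) = image (x ∘ suc) S

∈-image⁻ : ∀ {n N} (x : Fin n → Fin N) (S : Subset n) {j} → j ∈ image x S → ∃ λ a → a ∈ S × x a ≡ j
∈-image⁻ x [] j∈ = contradiction j∈ ∉⊥
∈-image⁻ x (true ∷ S) j∈ with x∈p∪q⁻ ⁅ x zero ⁆ _ j∈
... | inj₁ j∈⁅⁆ = zero , here , sym (x∈⁅y⁆⇒x≡y _ j∈⁅⁆)
... | inj₂ j∈im with ∈-image⁻ (x ∘ suc) S j∈im
... | a , a∈S , eq = suc a , there a∈S , eq
∈-image⁻ x (false ∷ S) j∈ with ∈-image⁻ (x ∘ suc) S j∈
... | a , a∈S , eq = suc a , there a∈S , eq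

∈-image⁺ : ∀ {n N} (x : Fin n → Fin N) {S : Subset n} {a} → a ∈ S → x a ∈ image x S
∈-image⁺ x {true ∷ S} here = p⊆p∪q _ (x∈⁅x⁆ _)
∈-image⁺ x {true ∷ S} (there a∈S) = q⊆p∪q ⁅ x zero ⁆ _ (∈-image⁺ (x ∘ suc) a∈S)
∈-image⁺ x {false ∷ S} (there a∈S) = ∈-image⁺ (x ∘ suc) a∈S

∣image∣ : ∀ {n N} (x : Fin n → Fin N) → Injective _≡_ _≡_ x → (S : Subset n) → ∣ image x S ∣ ≡ ∣ S ∣
∣image∣ {N = N} x inj [] = ∣⊥∣≡0 N
∣image∣ x inj (true ∷ S) = trans
  (∣p∪q∣≡∣p∣+∣q∣ ⁅ x zero ⁆ _ λ j∈⁅⁆ j∈im → disj (x∈⁅y⁆⇒x≡y _ j∈⁅⁆) (∈-image⁻ (x ∘ suc) S j∈im))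
  (cong₂ _+_ (∣⁅x⁆∣≡1 (x zero)) (∣image∣ (x ∘ suc) (suc-injective ∘ inj) S))
  where
  disj : ∀ {j} → j ≡ x zero → ¬ ∃ λ a → a ∈ S × x (suc a) ≡ j
  disj refl (a , _ , eq) with inj eq
  ... | ()
∣image∣ x inj (false ∷ S) = ∣image∣ (x ∘ suc) (suc-injective ∘ inj) S

preimage : ∀ {n N} → (Fin n → Fin N) → Subset N → Subset n
preimage x Z = tabulate (lookup Z ∘ x)

∈-preimage⁺ : ∀ {n N} (x : Fin n → Fin N) {Z a} → x a ∈ Z → a ∈ preimage x Z
∈-preimage⁺ x {Z} {a} xa∈Z = lookup⇒[]= a _ (trans (lookup∘tabulate (lookup Z ∘ x) a) ([]=⇒lookup xa∈Z))

∈-preimage⁻ : ∀ {n N} (x : Fin n → Fin N) {Z a} → a ∈ preimage x Z → x a ∈ Z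
∈-preimage⁻ x {Z} {a} a∈ = lookup⇒[]= (x a) Z (trans (sym (lookup∘tabulate (lookup Z ∘ x) a)) ([]=⇒lookup a∈))

module Copy {n N} (f : Subset n → Subset N) (emb : IsEmbedding _⊆_ f) where

  mono : ∀ {S T} → S ⊆ T → f S ⊆ f T
  mono {S} {T} = proj₁ (emb S T)

  private
    separated : ∀ a → ∃ λ x → x ∈ f ⁅ a ⁆ × x ∉ f (∁ ⁅ a ⁆)
    separated a = ⊈⇒∃∈∉ λ fa⊆ → x∈∁p⇒x∉p (proj₂ (emb _ _) (λ {x} → fa⊆ {x}) (x∈⁅x⁆ a)) (x∈⁅x⁆ a)

  -- Every copy of Q_n projects isomorphically to the coordinates x_a ∈ f {a} ∖ f ({a}ᶜ).
  coord : Fin n → Fin N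
  coord a = proj₁ (separated a)

  coord∈⁺ : ∀ {a S} → a ∈ S → coord a ∈ f S
  coord∈⁺ {a} {S} a∈S = mono ⁅a⁆⊆S (proj₁ (proj₂ (separated a)))
    where
    ⁅a⁆⊆S : ⁅ a ⁆ ⊆ S
    ⁅a⁆⊆S b∈ with refl ← x∈⁅y⁆⇒x≡y a b∈ = a∈S

  coord∈⁻ : ∀ {a S} → coord a ∈ f S → a ∈ S
  coord∈⁻ {a} {S} xa∈ = decidable-stable (a ∈? S) λ a∉S →
    proj₂ (proj₂ (separated a)) (mono (S⊆ a∉S) xa∈)
    where
    S⊆ : a ∉ S → S ⊆ ∁ ⁅ a ⁆
    S⊆ a∉S b∈S = x∉p⇒x∈∁p λ b∈ → a∉S (subst (_∈ S) (x∈⁅y⁆⇒x≡y a b∈) b∈S)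

  coord-injective : Injective _≡_ _≡_ coord
  coord-injective {a} {b} eq =
    sym (x∈⁅y⁆⇒x≡y a (coord∈⁻ (subst (_∈ f ⁅ a ⁆) eq (coord∈⁺ (x∈⁅x⁆ a)))))

  image⊆ : ∀ S → image coord S ⊆ f S
  image⊆ S j∈ with ∈-image⁻ coord S j∈
  ... | a , a∈S , refl = coord∈⁺ a∈S

  ∣S∣≤∣fS∣ : ∀ S → ∣ S ∣ ≤ ∣ f S ∣
  ∣S∣≤∣fS∣ S = subst (_≤ _) (∣image∣ coord coord-injective S) (p⊆q⇒∣p∣≤∣q∣ (image⊆ S))

  -- The coordinates of the `n - ∣ S ∣` elements outside `S` lie in `f ⊤` but not in `f S`.
  ∣fS∣+n≤∣f⊤∣+∣S∣ : ∀ S → ∣ f S ∣ + n ≤ ∣ f ⊤ ∣ + ∣ S ∣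
  ∣fS∣+n≤∣f⊤∣+∣S∣ S = begin
    ∣ f S ∣ + n                             ≡⟨ cong (∣ f S ∣ +_) (∣p∣+∣∁p∣≡n S) ⟨
    ∣ f S ∣ + (∣ S ∣ + ∣ ∁ S ∣)             ≡⟨ cong (∣ f S ∣ +_) (+-comm (∣ S ∣) _) ⟩
    ∣ f S ∣ + (∣ ∁ S ∣ + ∣ S ∣)             ≡⟨ +-assoc (∣ f S ∣) _ _ ⟨
    ∣ f S ∣ + ∣ ∁ S ∣ + ∣ S ∣               ≡⟨ cong (λ s → ∣ f S ∣ + s + ∣ S ∣) (∣image∣ coord coord-injective (∁ S)) ⟨
    ∣ f S ∣ + ∣ image coord (∁ S) ∣ + ∣ S ∣ ≤⟨ +-monoˡ-≤ ∣ S ∣ sizes ⟩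
    ∣ f ⊤ ∣ + ∣ S ∣                         ∎
    where
    open ≤-Reasoning
    disj : ∀ {j} → j ∈ f S → j ∉ image coord (∁ S)
    disj j∈fS j∈im with ∈-image⁻ coord (∁ S) j∈im
    ... | a , a∈∁S , refl = x∈∁p⇒x∉p a∈∁S (coord∈⁻ j∈fS)
    sizes : ∣ f S ∣ + ∣ image coord (∁ S) ∣ ≤ ∣ f ⊤ ∣
    sizes = disjoint⇒∣p∣+∣q∣≤∣r∣ disj (mono (⊆-max S)) (λ {x} → mono (⊆-max (∁ S)) ∘ image⊆ (∁ S))

-- Upper bounds, and the layered lower bound 2n

_≟ᶜ_ : DecidableEquality Colour
blue ≟ᶜ blue = yes refl
blue ≟ᶜ red  = no λ ()
red  ≟ᶜ blue = no λ ()
red  ≟ᶜ red  = yes refl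

≢red⇒blue : ∀ {x} → x ≢ red → x ≡ blue
≢red⇒blue {blue} _ = refl
≢red⇒blue {red}  ≢red = contradiction refl ≢red

≢blue⇒red : ∀ {x} → x ≢ blue → x ≡ red
≢blue⇒red {red}  _ = refl
≢blue⇒red {blue} ≢blue = contradiction refl ≢blue

altColour-suc : ∀ i → altColour i ≢ altColour (suc i)
altColour-suc zero ()
altColour-suc (suc zero) ()
altColour-suc (suc (suc i)) = altColour-suc i

≢altColour-suc : ∀ i {x} → x ≢ altColour (suc i) → x ≡ altColour i
≢altColour-suc zero = ≢blue⇒red
≢altColour-suc (suc zero) = ≢red⇒blue
≢altColour-suc (suc (suc i)) = ≢altColour-suc i

++-⊆⁺ : ∀ {m n} {p p′ : Subset m} {q q′ : Subset n} → p ⊆ p′ → q ⊆ q′ → p ++ q ⊆ p′ ++ q′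
++-⊆⁺ {p = []} {[]} _ q⊆q′ = q⊆q′
++-⊆⁺ {p = true ∷ p} {b ∷ p′} p⊆p′ q⊆q′ here with here ← p⊆p′ here = here
++-⊆⁺ {p = _ ∷ p} {_ ∷ p′} p⊆p′ q⊆q′ (there x∈) = there (++-⊆⁺ (drop-∷-⊆ p⊆p′) q⊆q′ x∈)

++-⊆⁻ʳ : ∀ {m n} (p p′ : Subset m) {q q′ : Subset n} → p ++ q ⊆ p′ ++ q′ → q ⊆ q′
++-⊆⁻ʳ [] [] ⊆ = ⊆
++-⊆⁻ʳ (_ ∷ p) (_ ∷ p′) ⊆ = ++-⊆⁻ʳ p p′ (drop-∷-⊆ ⊆)

++-⊆⁻ˡ : ∀ {m n} (p p′ : Subset m) {q q′ : Subset n} → p ++ q ⊆ p′ ++ q′ → p ⊆ p′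
++-⊆⁻ˡ (true ∷ p) (_ ∷ p′) ⊆ here with here ← ⊆ here = here
++-⊆⁻ˡ (_ ∷ p) (_ ∷ p′) ⊆ (there x∈) = there (++-⊆⁻ˡ p p′ (drop-∷-⊆ ⊆) x∈)

_++ᵉ : ∀ {m} (p : Subset m) {n} → IsEmbedding {m + n} _⊆_ (p ++_)
(p ++ᵉ) q q′ = (λ q⊆q′ → ++-⊆⁺ {p = p} ⊆-refl q⊆q′) , ++-⊆⁻ʳ p p

ᵉ++_ : ∀ {m n} (q : Subset n) → IsEmbedding {m + n} {Subset m} _⊆_ (_++ q)
(ᵉ++ q) p p′ = (λ p⊆p′ → ++-⊆⁺ {q = q} p⊆p′ ⊆-refl) , ++-⊆⁻ˡ p p′

HasCopy-∘ : ∀ {P M N} (c : Colouring N) {e : Subset M → Subset N} → IsEmbedding _⊆_ e →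
  HasCopy P (c ∘ e) → HasCopy P c
HasCopy-∘ c {e} e-emb (f , f-emb , colours) =
  e ∘ f
  , (λ x y → proj₁ (e-emb _ _) ∘ proj₁ (f-emb x y) , λ ⊆ → proj₂ (f-emb x y) (proj₂ (e-emb _ _) ⊆))
  , colours

-- The sets avoiding the last `o` elements form a copy of the smaller lattice.
Arrows-mono : ∀ {P n M N} → M ≤ N → Arrows P n M → Arrows P n N
Arrows-mono {M = M} M≤N arrows c with m≤n⇒∃[o]m+o≡n M≤N
... | o , refl = ⊎-map up (⊎-map up up) (arrows (c ∘ (_++ ⊥)))
  where
  up : ∀ {Q} → HasCopy Q (c ∘ (_++ ⊥)) → HasCopy Q c
  up {Q} = HasCopy-∘ {Q} c (ᵉ++ ⊥ {o})

-- Indexing by ℕ lets a chain be prolonged without arithmetic in `Fin`; only indices below `t`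
-- matter. Inclusions need not be assumed strict, as consecutive sets differ in colour.
record AltChain {N} (c : Colouring N) (t : ℕ) : Set where
  field
    seq       : ℕ → Subset N
    ascending : ∀ i → suc i < t → seq i ⊆ seq (suc i)
    colours   : ∀ i → i < t → c (seq i) ≡ altColour i

  ascending-≤ : ∀ i k → i + k < t → seq i ⊆ seq (i + k)
  ascending-≤ i zero    i+k<t rewrite +-identityʳ i = ⊆-refl
  ascending-≤ i (suc k) i+k<t rewrite +-suc i k =
    ascending (i + k) i+k<t ∘ ascending-≤ i k (<-trans (n<1+n _) i+k<t)

  monotone : ∀ {i j} → i ≤ j → j < t → seq i ⊆ seq j
  monotone {i} i≤j j<t with m≤n⇒∃[o]m+o≡n i≤j
  ... | k , refl = ascending-≤ i k j<t

  -- If j < i and seq i ⊆ seq j, then the consecutive sets seq j and seq (j + 1) coincide, though their colours differ.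
  reflecting : ∀ {i j} → i < t → seq i ⊆ seq j → i ≤ j
  reflecting {i} {j} i<t ⊆ with i ≤? j
  ... | yes i≤j = i≤j
  ... | no  i≰j = contradiction
    (trans (sym (colours j (<-trans j<i i<t))) (trans (cong c same) (colours (suc j) (≤-<-trans j<i i<t))))
    (altColour-suc j)
    where
    j<i = ≰⇒> i≰j
    same : seq j ≡ seq (suc j)
    same = ⊆-antisym (ascending j (≤-<-trans j<i i<t)) (λ {x} → ⊆ ∘ monotone j<i i<t)

  toCopy : HasCopy (rbrChain t) c
  toCopy = seq ∘ toℕ
    , (λ i j → (λ i≤j → monotone i≤j (toℕ<n j)) , reflecting (toℕ<n i))
    , λ i → colours (toℕ i) (toℕ<n i)

open AltChain using (toCopy)

extend : ∀ {A : Set} → (ℕ → A) → ℕ → A → ℕ → A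
extend s zero    z i       = z
extend s (suc t) z zero    = s zero
extend s (suc t) z (suc i) = extend (s ∘ suc) t z i

extend-< : ∀ {A : Set} (s : ℕ → A) {t} z {i} → i < t → extend s t z i ≡ s i
extend-< s z {zero}  z<s       = refl
extend-< s z {suc i} (s<s i<t) = extend-< (s ∘ suc) z i<t

extend-≡ : ∀ {A : Set} (s : ℕ → A) t z → extend s t z t ≡ z
extend-≡ s zero    z = refl
extend-≡ s (suc t) z = extend-≡ (s ∘ suc) t z

snoc : ∀ {N} {c : Colouring N} {t} (ch : AltChain c (suc t)) {Z} →
  AltChain.seq ch t ⊆ Z → c Z ≡ altColour (suc t) → AltChain c (suc (suc t))
snoc {c = c} {t} ch {Z} ⊆Z cZ = record
  { seq = extend seq (suc t) Z ; ascending = asc ; colours = col }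
  where
  open AltChain ch
  asc : ∀ i → suc i < suc (suc t) → extend seq (suc t) Z i ⊆ extend seq (suc t) Z (suc i)
  asc i (s<s i<1+t) rewrite extend-< seq Z i<1+t with m<1+n⇒m<n∨m≡n i<1+t
  ... | inj₁ i<t  rewrite extend-< seq Z (s<s i<t) = ascending i (s<s i<t)
  ... | inj₂ refl rewrite extend-≡ seq (suc t) Z = ⊆Z
  col : ∀ i → i < suc (suc t) → c (extend seq (suc t) Z i) ≡ altColour i
  col i i<2+t with m<1+n⇒m<n∨m≡n i<2+t
  ... | inj₁ i<1+t rewrite extend-< seq Z i<1+t = colours i i<1+t
  ... | inj₂ refl  rewrite extend-≡ seq (suc t) Z = cZ

chain₃ : ∀ {N} {c : Colouring N} {x y z} → x ⊆ y → y ⊆ z →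
  c x ≡ red → c y ≡ blue → c z ≡ red → AltChain c 3
chain₃ {x = x} x⊆y y⊆z cx cy cz = snoc (snoc one x⊆y cy) y⊆z cz
  where
  one = record { seq = λ _ → x ; ascending = λ { _ (s<s ()) } ; colours = λ { zero _ → cx ; (suc _) (s<s ()) } }

-- Keeps the chain as a sequence, so that its top set is at hand for the next prolongation.
AltArrows : ℕ → ℕ → ℕ → Set
AltArrows t n N = ∀ (c : Colouring N) →
  AltChain c t ⊎ (HasCopy (monoQ n blue) c ⊎ HasCopy (monoQ n red) c)

AltArrows⇒Arrows : ∀ {t n N} → AltArrows t n N → Arrows (rbrChain t) n N
AltArrows⇒Arrows arrows c = ⊎-map₁ toCopy (arrows c)

AltArrows-suc : ∀ {t n N} → AltArrows (suc t) n N → AltArrows (suc (suc t)) n (n + N)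
AltArrows-suc {t} {n} {N} arrows c with arrows (c ∘ (⊥ {n} ++_))
... | inj₂ copy = inj₂ (⊎-map up up copy)
  where
  up : ∀ {k} → HasCopy (monoQ n k) (c ∘ (⊥ {n} ++_)) → HasCopy (monoQ n k) c
  up {k} = HasCopy-∘ {monoQ n k} c (⊥ ++ᵉ)
-- The sets `W ++ ⊤` form a copy of Q_n and contain every set `⊥ ++ V` of the lower lattice, in
-- particular the top of the chain.
... | inj₁ ch with anySubset? (λ (W : Subset n) → c (W ++ ⊤ {N}) ≟ᶜ altColour (suc t))
...   | yes (W , cW) = inj₁ (snoc lifted {W ++ ⊤} (++-⊆⁺ {p = ⊥} {W} (⊆-min _) (⊆-max _)) cW)
  where
  open AltChain ch
  lifted : AltChain c (suc t)
  lifted = record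
    { seq = (⊥ ++_) ∘ seq
    ; ascending = λ i i<t → proj₁ ((⊥ ++ᵉ) _ _) (ascending i i<t)
    ; colours = colours }
...   | no none = inj₂ (sides (altColour t) λ W → ≢altColour-suc t λ eq → none (W , eq))
  where
  sides : ∀ k → (∀ (W : Subset n) → c (W ++ ⊤) ≡ k) → HasCopy (monoQ n blue) c ⊎ HasCopy (monoQ n red) c
  sides blue col = inj₁ ((_++ ⊤) , (ᵉ++ ⊤) , col)
  sides red  col = inj₂ ((_++ ⊤) , (ᵉ++ ⊤) , col)

-- Let X, Y be the two blocks of size n. If for some S ⊆ X a red set lies below S and no blue one lies in
-- [S, S ∪ Y], this interval is a red Q_n. Otherwise the map taking S to S when nothing below S is red, and to
-- S ∪ Y otherwise, is a blue copy, unless some such S ∪ Y is red and tops a chain.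
AltArrows₃ : ∀ n → AltArrows 3 n (n + n)
AltArrows₃ n c with anySubset? (λ S → redBelow? S ×-dec ¬? (blueBetween? S))
  module Base where
  RedBelow BlueBetween : Subset n → Set
  RedBelow S = ∃ λ R → R ⊆ ⊥ {n} ++ S × c R ≡ red
  BlueBetween S = ∃ λ B → (⊥ {n} ++ S ⊆ B × B ⊆ ⊤ {n} ++ S) × c B ≡ blue
  redBelow? : ∀ S → Dec (RedBelow S)
  redBelow? S = anySubset? λ R → (R ⊆? _) ×-dec (c R ≟ᶜ red)
  blueBetween? : ∀ S → Dec (BlueBetween S)
  blueBetween? S = anySubset? λ B → ((_ ⊆? B) ×-dec (B ⊆? _)) ×-dec (c B ≟ᶜ blue)
... | yes (S , _ , none) = inj₂ (inj₂ ((_++ S) , (ᵉ++ S)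
      , λ W → ≢blue⇒red λ cW → none (W ++ S , (++-⊆⁺ {p = ⊥} {W} (⊆-min _) ⊆-refl , ++-⊆⁺ {p = W} (⊆-max _) ⊆-refl) , cW)))
... | no ¬redInterval with anySubset? (λ S → Base.redBelow? n c S ×-dec (c (⊤ {n} ++ S) ≟ᶜ red))
...   | yes (S , (R , R⊆ , cR) , cS)
      with B , (S⊆B , B⊆) , cB ← decidable-stable (Base.blueBetween? n c S)
             (λ none → ¬redInterval (S , (R , R⊆ , cR) , none)) =
      inj₁ (chain₃ {x = R} (λ {x} → S⊆B ∘ R⊆) B⊆ cR cB cS)
...   | no ¬redTop = inj₂ (inj₁ (f , (λ S T → f-mono S T , f-reflect S T) , f-blue))
  where
  open Base n c
  f : Subset n → Subset (n + n)
  f S with redBelow? S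
  ... | yes _ = ⊤ ++ S
  ... | no  _ = ⊥ ++ S
  f-mono : ∀ S T → S ⊆ T → f S ⊆ f T
  f-mono S T S⊆T with redBelow? S | redBelow? T
  ... | yes _ | yes _ = ++-⊆⁺ {p = ⊤} ⊆-refl S⊆T
  ... | yes (R , R⊆ , cR) | no none =
    contradiction (R , (λ {x} → ++-⊆⁺ {p = ⊥} ⊆-refl S⊆T ∘ R⊆) , cR) none
  ... | no _ | yes _ = ++-⊆⁺ {p = ⊥} (⊆-min _) S⊆T
  ... | no _ | no _ = ++-⊆⁺ {p = ⊥} ⊆-refl S⊆T
  f-reflect : ∀ S T → f S ⊆ f T → S ⊆ T
  f-reflect S T ⊆ with redBelow? S | redBelow? T
  ... | yes _ | yes _ = ++-⊆⁻ʳ (⊤ {n}) ⊤ ⊆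
  ... | yes _ | no  _ = ++-⊆⁻ʳ (⊤ {n}) ⊥ ⊆
  ... | no  _ | yes _ = ++-⊆⁻ʳ (⊥ {n}) ⊤ ⊆
  ... | no  _ | no  _ = ++-⊆⁻ʳ (⊥ {n}) ⊥ ⊆
  f-blue : ∀ S → c (f S) ≡ blue
  f-blue S with redBelow? S
  ... | yes r    = ≢red⇒blue λ cS → ¬redTop (S , r , cS)
  ... | no  none = ≢red⇒blue λ cS → none (_ , ⊆-refl , cS)

AltArrows-upper : ∀ t n → AltArrows (3 + t) n ((2 + t) * n)
AltArrows-upper zero    n = subst (AltArrows 3 n) (cong (n +_) (sym (+-identityʳ n))) (AltArrows₃ n)
AltArrows-upper (suc t) n = AltArrows-suc (AltArrows-upper t n)

truncate : ∀ {s t N} (c : Colouring N) → s ≤ t → HasCopy (rbrChain t) c → HasCopy (rbrChain s) c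
truncate c s≤t (f , emb , col) = f ∘ inj
  , (λ i j → proj₁ (emb _ _) ∘ subst₂ _≤_ (sym (toℕ-inject≤ i s≤t)) (sym (toℕ-inject≤ j s≤t))
           , λ ⊆ → subst₂ _≤_ (toℕ-inject≤ i s≤t) (toℕ-inject≤ j s≤t) (proj₂ (emb _ _) ⊆))
  , λ i → trans (col (inj i)) (cong altColour (toℕ-inject≤ i s≤t))
  where
  inj = λ i → inject≤ i s≤t

layered : ∀ n N → Colouring N
layered n N Z with ∣ Z ∣ <? n
... | yes _ = blue
... | no  _ = red

layered-blue : ∀ n {N} (Z : Subset N) → layered n N Z ≡ blue → ∣ Z ∣ < n
layered-blue n Z eq with ∣ Z ∣ <? n
... | yes <n = <n

layered-red : ∀ n {N} (Z : Subset N) → layered n N Z ≡ red → n ≤ ∣ Z ∣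
layered-red n Z eq with ∣ Z ∣ <? n
... | no ≮n = ≮⇒≥ ≮n

-- In `layered n M` blue sets are smaller than red ones, so no red set lies below a blue one. There
-- are at most `n` levels of either colour, while a copy of Q_n needs `n + 1`.
Arrows-lower₂ : ∀ t n M → 2 ≤ t → M < 2 * n → ¬ Arrows (rbrChain t) n M
Arrows-lower₂ t n M 2≤t M<2n arrows with arrows (layered n M)
... | inj₁ copy = noChain (truncate (layered n M) 2≤t copy)
  where
  noChain : ¬ HasCopy (rbrChain 2) (layered n M)
  noChain (f , emb , col) = <-irrefl refl (begin-strict
    ∣ f (suc zero) ∣ <⟨ layered-blue n _ (col (suc zero)) ⟩
    n                ≤⟨ layered-red n _ (col zero) ⟩
    ∣ f zero ∣       ≤⟨ p⊆q⇒∣p∣≤∣q∣ (proj₁ (emb zero (suc zero)) z≤n) ⟩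
    ∣ f (suc zero) ∣ ∎)
    where open ≤-Reasoning
... | inj₂ (inj₁ (f , emb , col)) = <⇒≱ (layered-blue n _ (col ⊤))
  (subst (_≤ ∣ f ⊤ ∣) (∣⊤∣≡n n) (Copy.∣S∣≤∣fS∣ f emb ⊤))
... | inj₂ (inj₂ (f , emb , col)) = <⇒≱ M<2n (begin
    n + (n + 0)         ≡⟨ cong (n +_) (+-identityʳ n) ⟩
    n + n               ≤⟨ +-monoˡ-≤ n (layered-red n _ (col ⊥)) ⟩
    ∣ f ⊥ ∣ + n         ≤⟨ Copy.∣fS∣+n≤∣f⊤∣+∣S∣ f emb ⊥ ⟩
    ∣ f ⊤ ∣ + ∣ ⊥ {n} ∣ ≡⟨ cong (∣ f ⊤ ∣ +_) (∣⊥∣≡0 n) ⟩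
    ∣ f ⊤ ∣ + 0         ≡⟨ +-identityʳ (∣ f ⊤ ∣) ⟩
    ∣ f ⊤ ∣             ≤⟨ ∣p∣≤n (f ⊤) ⟩
    M                   ∎)
  where open ≤-Reasoning

Arrows-truncate : ∀ {s t n N} → s ≤ t → Arrows (rbrChain t) n N → Arrows (rbrChain s) n N
Arrows-truncate s≤t arrows c = ⊎-map₁ (truncate c s≤t) (arrows c)

-- Decidability of the arrow relation

Searchable : Set → Set₁
Searchable A = ∀ {P : A → Set} → Decidable P → Dec (∃ P)

-- Without function extensionality, only predicates that respect pointwise equality can be searched over functions.
FunSearchable : Set → Set → Set₁
FunSearchable A B = ∀ {P : (A → B) → Set} → (∀ {f g} → f ≗ g → P f → P g) → Decidable P → Dec (∃ P)

∀-dec : ∀ {A} → Searchable A → ∀ {P : A → Set} → Decidable P → Dec (∀ x → P x)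
∀-dec search P? = map′ (λ none x → decidable-stable (P? x) λ ¬px → none (x , ¬px))
  (λ all (x , ¬px) → ¬px (all x)) (¬? (search (¬? ∘ P?)))

searchColour : Searchable Colour
searchColour {P} P? = map′ from to (P? blue ⊎-dec P? red)
  where
  from : P blue ⊎ P red → ∃ P
  from (inj₁ p) = blue , p
  from (inj₂ p) = red , p
  to : ∃ P → P blue ⊎ P red
  to (blue , p) = inj₁ p
  to (red  , p) = inj₂ p

searchFin→ : ∀ t {B} → Searchable B → FunSearchable (Fin t) B
searchFin→ zero search resp P? = map′ (_ ,_) (λ (f , pf) → resp (λ ()) pf) (P? λ ())
searchFin→ (suc t) {B} search {P} resp P? =
  map′ (λ (b , g , p) → cons b g , p) (λ (f , p) → f zero , f ∘ suc , resp (cons-η f) p)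
    (search λ b → searchFin→ t search (λ eq → resp (cons-cong eq)) (P? ∘ cons b))
  where
  cons : B → (Fin t → B) → Fin (suc t) → B
  cons b g zero    = b
  cons b g (suc i) = g i
  cons-cong : ∀ {b g h} → g ≗ h → cons b g ≗ cons b h
  cons-cong eq zero    = refl
  cons-cong eq (suc i) = eq i
  cons-η : ∀ f → f ≗ cons (f zero) (f ∘ suc)
  cons-η f zero    = refl
  cons-η f (suc i) = refl

-- A function on `Subset (suc n)` amounts to its two restrictions, to the sets with and without the
-- first element.
searchSubset→ : ∀ n {B} → Searchable B → FunSearchable (Subset n) B
searchSubset→ zero search resp P? =
  map′ (λ (b , p) → (λ _ → b) , p) (λ (f , p) → f [] , resp (λ { [] → refl }) p) (search (P? ∘ λ b _ → b))
searchSubset→ (suc n) {B} search {P} resp P? =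
  map′ (λ (g , h , p) → join g h , p) (λ (f , p) → f ∘ (true ∷_) , f ∘ (false ∷_) , resp (join-η f) p)
    (searchSubset→ n search (λ eq (h , p) → h , resp (join-cong eq λ _ → refl) p)
      λ g → searchSubset→ n search (λ eq → resp (join-cong (λ _ → refl) eq)) (P? ∘ join g))
  where
  join : (Subset n → B) → (Subset n → B) → Subset (suc n) → B
  join g h (true  ∷ S) = g S
  join g h (false ∷ S) = h S
  join-cong : ∀ {g g′ h h′} → g ≗ g′ → h ≗ h′ → join g h ≗ join g′ h′
  join-cong g≗ h≗ (true  ∷ S) = g≗ S
  join-cong g≗ h≗ (false ∷ S) = h≗ S
  join-η : ∀ f → f ≗ join (f ∘ (true ∷_)) (f ∘ (false ∷_))
  join-η f (true  ∷ S) = refl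
  join-η f (false ∷ S) = refl

module _ (P : ColouredPoset) where
  open ColouredPoset P renaming (_≤_ to _≤ᴾ_)

  HasCopy-cong : ∀ {N} {c d : Colouring N} → c ≗ d → HasCopy P c → HasCopy P d
  HasCopy-cong c≗d (f , emb , col) = f , emb , λ x → trans (sym (c≗d (f x))) (col x)

  hasCopy? : (∀ {Q : Carrier → Set} → Decidable Q → Dec (∀ x → Q x)) → (∀ x y → Dec (x ≤ᴾ y)) →
    ∀ {N} → FunSearchable Carrier (Subset N) → (c : Colouring N) → Dec (HasCopy P c)
  hasCopy? all _≤ᴾ?_ search c = search
    (λ f≗g (emb , col) →
      (λ x y → subst₂ (λ X Y → (x ≤ᴾ y → X ⊆ Y) × (X ⊆ Y → x ≤ᴾ y)) (f≗g x) (f≗g y) (emb x y))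
      , λ x → subst (λ X → c X ≡ colour x) (f≗g x) (col x))
    λ f → all (λ x → all λ y → ((x ≤ᴾ? y) →-dec (f x ⊆? f y)) ×-dec ((f x ⊆? f y) →-dec (x ≤ᴾ? y)))
      ×-dec all (λ x → c (f x) ≟ᶜ colour x)

-- Every quantifier ranges over a finite domain, so exhaustive search decides the relation. This
-- makes the Ramsey number, as a least `N`, available constructively.
arrows? : ∀ t n N → Dec (Arrows (rbrChain t) n N)
arrows? t n N = map′
  (λ none c → decidable-stable (good? c) λ bad → none (c , bad))
  (λ arrows (c , bad) → bad (arrows c))
  (¬? (searchSubset→ N searchColour
    (λ c≗d bad → bad ∘ ⊎-map (recolour (rbrChain t) c≗d) (⊎-map (recolour (monoQ n blue) c≗d) (recolour (monoQ n red) c≗d)))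
    (¬? ∘ good?)))
  where
  recolour : ∀ P {c d : Colouring N} → c ≗ d → HasCopy P d → HasCopy P c
  recolour P c≗d = HasCopy-cong P (sym ∘ c≗d)
  mono? : ∀ k (c : Colouring N) → Dec (HasCopy (monoQ n k) c)
  mono? k = hasCopy? (monoQ n k) (∀-dec anySubset?) _⊆?_ (searchSubset→ n anySubset?)
  good? : ∀ c → Dec (HasCopy (rbrChain t) c ⊎ (HasCopy (monoQ n blue) c ⊎ HasCopy (monoQ n red) c))
  good? c = hasCopy? (rbrChain t) all? _≤ᶠ?_ (searchFin→ t anySubset?) c ⊎-dec (mono? blue c ⊎-dec mono? red c)

least : ∀ {P : ℕ → Set} → Decidable P → ∀ n → P n → ∃ λ N → (P N × (∀ M → M < N → ¬ P M)) × N ≤ n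
least P? zero p = zero , (p , λ _ ()) , z≤n
least P? (suc n) p with P? 0
... | yes p₀ = 0 , (p₀ , λ _ ()) , z≤n
... | no ¬p₀ with least (P? ∘ suc) n p
...   | N , (pN , below) , N≤n =
        suc N , (pN , λ { zero _ → ¬p₀ ; (suc M) (s≤s M<N) → below M M<N }) , s≤s N≤n

-- A four-class colouring from a sparse cover

∣p∣≤∣p─q∣+∣q∣ : ∀ {N} (p q : Subset N) → ∣ p ∣ ≤ ∣ p ─ q ∣ + ∣ q ∣
∣p∣≤∣p─q∣+∣q∣ [] [] = z≤n
∣p∣≤∣p─q∣+∣q∣ (true  ∷ p) (true  ∷ q) = ≤-trans (s≤s (∣p∣≤∣p─q∣+∣q∣ p q)) (≤-reflexive (sym (+-suc (∣ p ─ q ∣) _)))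
∣p∣≤∣p─q∣+∣q∣ (true  ∷ p) (false ∷ q) = s≤s (∣p∣≤∣p─q∣+∣q∣ p q)
∣p∣≤∣p─q∣+∣q∣ (false ∷ p) (true  ∷ q) =
  ≤-trans (m≤n⇒m≤1+n (∣p∣≤∣p─q∣+∣q∣ p q)) (≤-reflexive (sym (+-suc (∣ p ─ q ∣) _)))
∣p∣≤∣p─q∣+∣q∣ (false ∷ p) (false ∷ q) = ∣p∣≤∣p─q∣+∣q∣ p q

x∈p-y⇒x≢y : ∀ {N} (p : Subset N) {x y} → x ∈ p - y → x ≢ y
x∈p-y⇒x≢y p {x} x∈ refl = <-irrefl (cong ∣_∣ (same p x)) (x∈p⇒∣p-x∣<∣p∣ x∈)
  where
  same : ∀ {N} (p : Subset N) x → p - x - x ≡ p - x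
  same p x = p─q─q≡p─q p ⁅ x ⁆

-- One deletion per list entry suffices: an element deleted for one entry stays outside the final
-- set.
removeHits : ∀ {n} {A : Set} (Hit : Fin n → A → Set) (S : Subset n) (L : List A) →
  All (λ J → ∃ λ a → a ∈ S × Hit a J) L →
  ∃ λ S′ → S′ ⊆ S × ∣ S ∣ ≤ ∣ S′ ∣ + length L × All (λ J → ∃ λ a → a ∉ S′ × Hit a J) L
removeHits Hit S [] [] = S , ⊆-refl , ≤-reflexive (sym (+-identityʳ _)) , []
removeHits Hit S (J ∷ L) ((a , _ , hit) ∷ hits) with removeHits Hit S L hits
... | S′ , S′⊆S , size , missed =
  S′ - a , (λ {x} → S′⊆S ∘ p─q⊆p S′ ⁅ a ⁆)
  , (begin
      ∣ S ∣                                  ≤⟨ size ⟩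
      ∣ S′ ∣ + length L                      ≤⟨ +-monoˡ-≤ (length L) (∣p∣≤∣p─q∣+∣q∣ S′ ⁅ a ⁆) ⟩
      ∣ S′ - a ∣ + ∣ ⁅ a ⁆ ∣ + length L      ≡⟨ cong (λ s → ∣ S′ - a ∣ + s + length L) (∣⁅x⁆∣≡1 a) ⟩
      ∣ S′ - a ∣ + 1 + length L              ≡⟨ +-assoc (∣ S′ - a ∣) 1 _ ⟩
      ∣ S′ - a ∣ + suc (length L)            ∎)
  , (a , (λ a∈ → x∈p-y⇒x≢y S′ a∈ refl) , hit)
  ∷ All.map (λ (b , b∉ , hit) → b , (λ b∈ → b∉ (p─q⊆p S′ ⁅ a ⁆ b∈)) , hit) missed
  where open ≤-Reasoning

-- `cover` is aimed at red copies, with `F` inside the image of `⊥` and `X` the set of coordinates;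
-- `sparse` is aimed at blue copies.
record SparseCover (N n α ℓ τ k : ℕ) : Set where
  field
    family : List (Subset N)
    size   : ∀ {J} → J ∈ᴸ family → ∣ J ∣ ≡ α + ℓ
    cover  : ∀ F X → ∣ F ∣ ≡ α → ∣ X ∣ ≡ n → (∀ {x} → x ∈ F → x ∉ X) →
             ∃ λ J → J ∈ᴸ family × J ⊆ F ∪ X × ∣ J ∩ X ∣ ≡ ℓ
    sparse : ∀ T → ∣ T ∣ ≤ τ → length (filter (_⊆? T) family) ≤ k

-- Up to a fourth class of red sets at the top, the colour classes are, from the bottom: the sets with at most κ
-- elements (blue), those containing no member of the family (red), those containing one (blue).
module Colouring₄ {n κ ℓ k} (cov : SparseCover (n + n + κ) n (suc κ) ℓ (suc κ + k + κ + ℓ) k)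
  (α+k≤n : suc κ + k ≤ n) where

  open SparseCover cov

  N α β : ℕ
  N = n + n + κ
  α = suc κ
  -- The value makes `β + n` exceed `N + ℓ` by one, which excludes red copies; a blue copy with
  -- `∣ f ⊤ ∣ < β` satisfies `∣ f S ∣ ≤ ∣ S ∣ + κ + ℓ`.
  β = n + κ + suc ℓ

  c : Colouring N
  c Z with ∣ Z ∣ <? α | β ≤? ∣ Z ∣ | Any.any? (_⊆? Z) family
  ... | yes _ | _     | _     = blue
  ... | no _  | yes _ | _     = red
  ... | no _  | no _  | yes _ = blue
  ... | no _  | no _  | no _  = red

  red⇒large : ∀ Z → c Z ≡ red → α ≤ ∣ Z ∣
  red⇒large Z eq with ∣ Z ∣ <? α | β ≤? ∣ Z ∣ | Any.any? (_⊆? Z) family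
  ... | no ≮α | yes _ | _     = ≮⇒≥ ≮α
  ... | no ≮α | no _  | no _  = ≮⇒≥ ≮α

  red∧⊇J⇒top : ∀ Z → c Z ≡ red → Any (_⊆ Z) family → β ≤ ∣ Z ∣
  red∧⊇J⇒top Z eq ⊇J with ∣ Z ∣ <? α | β ≤? ∣ Z ∣ | Any.any? (_⊆? Z) family
  ... | no _  | yes top | _     = top
  ... | no _  | no _  | no none = contradiction ⊇J none

  blue∧large : ∀ Z → c Z ≡ blue → α ≤ ∣ Z ∣ → ∣ Z ∣ < β × Any (_⊆ Z) family
  blue∧large Z eq large with ∣ Z ∣ <? α | β ≤? ∣ Z ∣ | Any.any? (_⊆? Z) family
  ... | yes <α | _      | _      = contradiction large (<⇒≱ <α)
  ... | no _   | no ≱β  | yes ⊇J = ≰⇒> ≱β , ⊇J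

  -- Levels never drop along the chain: the first red set leaves the lowest level, so the next blue
  -- one contains a member of the family, the next red one has size at least `β`, and no blue set
  -- contains that.
  noChain : ¬ HasCopy (rbrChain 4) c
  noChain (f , emb , col) = <⇒≱ (proj₁ (blue∧large x₃ (col _) large₃)) (≤-trans top (p⊆q⇒∣p∣≤∣q∣ x₂⊆x₃))
    where
    x₀ = f zero
    x₁ = f (suc zero)
    x₂ = f (suc (suc zero))
    x₃ = f (suc (suc (suc zero)))
    x₀⊆x₁ : x₀ ⊆ x₁
    x₀⊆x₁ = proj₁ (emb _ _) z≤n
    x₁⊆x₂ : x₁ ⊆ x₂
    x₁⊆x₂ = proj₁ (emb _ _) (s≤s z≤n)
    x₂⊆x₃ : x₂ ⊆ x₃
    x₂⊆x₃ = proj₁ (emb _ _) (s≤s (s≤s z≤n))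
    large₁ : α ≤ ∣ x₁ ∣
    large₁ = ≤-trans (red⇒large x₀ (col _)) (p⊆q⇒∣p∣≤∣q∣ x₀⊆x₁)
    large₃ : α ≤ ∣ x₃ ∣
    large₃ = ≤-trans large₁ (p⊆q⇒∣p∣≤∣q∣ (λ {x} → x₂⊆x₃ ∘ x₁⊆x₂))
    top : β ≤ ∣ x₂ ∣
    top = red∧⊇J⇒top x₂ (col _)
      (Any.map {P = _⊆ x₁} {Q = _⊆ x₂} (λ J⊆x₁ {x} → x₁⊆x₂ ∘ J⊆x₁) (proj₂ (blue∧large x₁ (col _) large₁)))

  -- Cover `α` elements of `f ⊥` and the coordinates by some `J`. Then `J ⊆ f S` for a set `S` of at
  -- most `ℓ` elements, so the red set `f S` has size at least `β`, and too little room remains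
  -- above it for the other `n - ℓ` coordinates.
  noRed : ¬ HasCopy (monoQ n red) c
  noRed (f , emb , col) with subsetOfSize (f ⊥) α (red⇒large (f ⊥) (col ⊥))
  ... | F , F⊆f⊥ , ∣F∣≡α with cover F (image coord ⊤) ∣F∣≡α
                              (trans (∣image∣ coord coord-injective ⊤) (∣⊤∣≡n n)) disj
    where
    open Copy f emb
    disj : ∀ {j} → j ∈ F → j ∉ image coord ⊤
    disj j∈F j∈X with ∈-image⁻ coord ⊤ j∈X
    ... | a , _ , refl = ∉⊥ (coord∈⁻ (F⊆f⊥ j∈F))
  ...   | J , J∈ , J⊆F∪X , ∣J∩X∣≡ℓ = <-irrefl refl (begin-strict
    N + ℓ               <⟨ n<1+n _ ⟩
    suc (N + ℓ)         ≡⟨ arith n κ ℓ ⟩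
    β + n               ≤⟨ +-monoˡ-≤ n top ⟩
    ∣ f S ∣ + n         ≤⟨ ∣fS∣+n≤∣f⊤∣+∣S∣ S ⟩
    ∣ f ⊤ ∣ + ∣ S ∣     ≤⟨ +-mono-≤ (∣p∣≤n (f ⊤)) ∣S∣≤ℓ ⟩
    N + ℓ               ∎)
    where
    open Copy f emb
    open ≤-Reasoning
    S : Subset n
    S = preimage coord J
    arith : ∀ n κ ℓ → suc (n + n + κ + ℓ) ≡ n + κ + suc ℓ + n
    arith = solve-∀
    J⊆fS : J ⊆ f S
    J⊆fS j∈J with x∈p∪q⁻ F _ (J⊆F∪X j∈J)
    ... | inj₁ j∈F = mono (⊆-min S) (F⊆f⊥ j∈F)
    ... | inj₂ j∈X with ∈-image⁻ coord ⊤ j∈X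
    ...   | a , _ , refl = coord∈⁺ (∈-preimage⁺ coord {J} j∈J)
    top : β ≤ ∣ f S ∣
    top = red∧⊇J⇒top (f S) (col S) (lose J∈ J⊆fS)
    imS⊆ : image coord S ⊆ J ∩ image coord ⊤
    imS⊆ j∈ with ∈-image⁻ coord S j∈
    ... | a , a∈S , refl = x∈p∩q⁺ (∈-preimage⁻ coord a∈S , ∈-image⁺ coord {⊤} ∈⊤)
    ∣S∣≤ℓ : ∣ S ∣ ≤ ℓ
    ∣S∣≤ℓ = begin
      ∣ S ∣                    ≡⟨ ∣image∣ coord coord-injective S ⟨
      ∣ image coord S ∣        ≤⟨ p⊆q⇒∣p∣≤∣q∣ imS⊆ ⟩
      ∣ J ∩ image coord ⊤ ∣    ≡⟨ ∣J∩X∣≡ℓ ⟩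
      ℓ                        ∎

  module _ (f : Subset n → Subset N) (emb : IsEmbedding _⊆_ f) (col : ∀ S → c (f S) ≡ blue)
    (S : Subset n) (∣S∣≡α+k : ∣ S ∣ ≡ α + k) where

    private
      open Copy f emb
      open ≤-Reasoning

      ∣f⊤∣<β : ∣ f ⊤ ∣ < β
      ∣f⊤∣<β = proj₁ (blue∧large (f ⊤) (col ⊤) (begin
        α           ≤⟨ m≤m+n α k ⟩
        α + k       ≤⟨ α+k≤n ⟩
        n           ≡⟨ ∣⊤∣≡n n ⟨
        ∣ ⊤ {n} ∣   ≤⟨ ∣S∣≤∣fS∣ ⊤ ⟩
        ∣ f ⊤ ∣     ∎))
      arith₁ : ∀ n κ ℓ s → n + κ + suc ℓ + s ≡ suc (s + κ + ℓ + n)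
      arith₁ = solve-∀
      ∣fS∣≤ : ∣ f S ∣ ≤ α + k + κ + ℓ
      ∣fS∣≤ = +-cancelʳ-≤ n _ _ (≤-pred (begin-strict
        ∣ f S ∣ + n               ≤⟨ ∣fS∣+n≤∣f⊤∣+∣S∣ S ⟩
        ∣ f ⊤ ∣ + ∣ S ∣           <⟨ +-monoˡ-< (∣ S ∣) ∣f⊤∣<β ⟩
        β + ∣ S ∣                 ≡⟨ cong (β +_) ∣S∣≡α+k ⟩
        β + (α + k)               ≡⟨ arith₁ n κ ℓ (α + k) ⟩
        suc (α + k + κ + ℓ + n)   ∎))
      arith₂ : ∀ κ ℓ s → suc (s + κ + ℓ) ≡ suc κ + ℓ + s
      arith₂ = solve-∀
      -- A member inside `f S` avoiding the coordinates of `S` would give `f S` at least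
      -- `(α + ℓ) + (α + k)` elements, one more than `∣fS∣≤` allows.
      meets : ∀ {J} → J ∈ᴸ filter (_⊆? f S) family → ∃ λ a → a ∈ S × coord a ∈ J
      meets {J} J∈ with ∈-filter⁻ (_⊆? f S) {xs = family} J∈
      ... | J∈𝓙 , J⊆fS with nonempty? (J ∩ image coord S)
      ...   | yes (j , j∈) with x∈p∩q⁻ J _ j∈
      ...     | j∈J , j∈im with ∈-image⁻ coord S j∈im
      ...       | a , a∈S , refl = a , a∈S , j∈J
      meets {J} J∈ | J∈𝓙 , J⊆fS | no disj = contradiction ∣fS∣≤ (<⇒≱ (begin
        suc (α + k + κ + ℓ)           ≡⟨ arith₂ κ ℓ (α + k) ⟩
        α + ℓ + (α + k)               ≡⟨ cong₂ _+_ (size J∈𝓙) (trans (∣image∣ coord coord-injective S) ∣S∣≡α+k) ⟨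
        ∣ J ∣ + ∣ image coord S ∣     ≤⟨ disjoint⇒∣p∣+∣q∣≤∣r∣ (λ j∈J j∈im → disj (_ , x∈p∩q⁺ (j∈J , j∈im))) J⊆fS (image⊆ S) ⟩
        ∣ f S ∣                       ∎))

    -- As f S is small, it contains at most k members of the family, and each of these meets the coordinates of S.
    -- Deleting k elements from S breaks them all, yet leaves a blue set.
    noBlueAt : Absurd
    noBlueAt with removeHits (λ a J → coord a ∈ J) S (filter (_⊆? f S) family) (All.tabulate meets)
    ... | S′ , S′⊆S , size-S , missed with find (proj₂ (blue∧large (f S′) (col S′) (≤-trans large (∣S∣≤∣fS∣ S′))))
      where
      large : α ≤ ∣ S′ ∣
      large = +-cancelʳ-≤ k _ _ (begin
        α + k                                             ≡⟨ ∣S∣≡α+k ⟨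
        ∣ S ∣                                             ≤⟨ size-S ⟩
        ∣ S′ ∣ + length (filter (_⊆? f S) family)         ≤⟨ +-monoʳ-≤ (∣ S′ ∣) (sparse (f S) ∣fS∣≤) ⟩
        ∣ S′ ∣ + k                                        ∎)
    ...   | J , J∈𝓙 , J⊆fS′
      with All.lookup missed (∈-filter⁺ (_⊆? f S) J∈𝓙 (λ {x} → mono S′⊆S ∘ J⊆fS′))
    ...     | a , a∉S′ , xa∈J = a∉S′ (coord∈⁻ (J⊆fS′ xa∈J))

  noBlue : ¬ HasCopy (monoQ n blue) c
  -- After the deletion of `k` elements, `α` remain, enough to keep the image out of the lowest
  -- level.
  noBlue (f , emb , col) with subsetOfSize (⊤ {n}) (α + k) (subst (α + k ≤_) (sym (∣⊤∣≡n n)) α+k≤n)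
  ... | S , _ , ∣S∣≡α+k = noBlueAt f emb col S ∣S∣≡α+k

  ¬Arrows₄ : ¬ Arrows (rbrChain 4) n N
  ¬Arrows₄ arrows with arrows c
  ... | inj₁ chain        = noChain chain
  ... | inj₂ (inj₁ copy) = noBlue copy
  ... | inj₂ (inj₂ copy) = noRed copy

-- Conditional expectations and counting

∑ ∏ : {A : Set} → List A → (A → ℕ) → ℕ
∑ []       f = 0
∑ (x ∷ xs) f = f x + ∑ xs f
∏ []       f = 1
∏ (x ∷ xs) f = f x * ∏ xs f

module _ {A : Set} where

  ∑-mono : ∀ (xs : List A) {f g} → (∀ x → f x ≤ g x) → ∑ xs f ≤ ∑ xs g
  ∑-mono []       f≤g = z≤n
  ∑-mono (x ∷ xs) f≤g = +-mono-≤ (f≤g x) (∑-mono xs f≤g)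

  ∑-cong : ∀ (xs : List A) {f g} → (∀ x → f x ≡ g x) → ∑ xs f ≡ ∑ xs g
  ∑-cong []       f≡g = refl
  ∑-cong (x ∷ xs) f≡g = cong₂ _+_ (f≡g x) (∑-cong xs f≡g)

  ∑-const : ∀ (xs : List A) k → ∑ xs (λ _ → k) ≡ length xs * k
  ∑-const []       k = refl
  ∑-const (x ∷ xs) k = cong (k +_) (∑-const xs k)

  ∑-+ : ∀ (xs : List A) f g → ∑ xs (λ x → f x + g x) ≡ ∑ xs f + ∑ xs g
  ∑-+ []       f g = refl
  ∑-+ (x ∷ xs) f g = trans (cong (f x + g x +_) (∑-+ xs f g)) (interchange (f x) (g x) _ _)
    where
    interchange : ∀ a b c d → a + b + (c + d) ≡ a + c + (b + d)
    interchange = solve-∀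

  ∑-*ˡ : ∀ (xs : List A) k f → ∑ xs (λ x → k * f x) ≡ k * ∑ xs f
  ∑-*ˡ []       k f = sym (*-zeroʳ k)
  ∑-*ˡ (x ∷ xs) k f = trans (cong (k * f x +_) (∑-*ˡ xs k f)) (sym (*-distribˡ-+ k (f x) _))

  ∑-++ : ∀ (xs ys : List A) f → ∑ (xs ++ᴸ ys) f ≡ ∑ xs f + ∑ ys f
  ∑-++ []       ys f = refl
  ∑-++ (x ∷ xs) ys f = trans (cong (f x +_) (∑-++ xs ys f)) (sym (+-assoc (f x) _ _))

  ∑-map : ∀ {B : Set} (g : B → A) xs f → ∑ (map g xs) f ≡ ∑ xs (f ∘ g)
  ∑-map g []       f = refl
  ∑-map g (x ∷ xs) f = cong (f (g x) +_) (∑-map g xs f)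

  ∈⇒≤∑ : ∀ {xs : List A} {x} f → x ∈ᴸ xs → f x ≤ ∑ xs f
  ∈⇒≤∑ f (here refl) = m≤m+n _ _
  ∈⇒≤∑ f (there x∈)  = ≤-trans (∈⇒≤∑ f x∈) (m≤n+m _ _)

  -- The first argument is the answer for the empty list, where the bound reads `0 ≤ 0`.
  belowAverage : A → ∀ xs f → ∃ λ y → length xs * f y ≤ ∑ xs f
  belowAverage d []       f = d , z≤n
  belowAverage d (x ∷ xs) f with belowAverage x xs f
  ... | y , below with ≤-total (f x) (f y)
  ...   | inj₁ fx≤fy = x , +-monoʳ-≤ (f x) (≤-trans (*-monoʳ-≤ (length xs) fx≤fy) below)
  ...   | inj₂ fy≤fx = y , +-mono-≤ fy≤fx below

∑-swap : ∀ {A B : Set} (xs : List A) (ys : List B) (f : A → B → ℕ) →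
  ∑ xs (λ x → ∑ ys (f x)) ≡ ∑ ys (λ y → ∑ xs (λ x → f x y))
∑-swap []       ys f = trans (sym (*-zeroʳ (length ys))) (sym (∑-const ys 0))
∑-swap (x ∷ xs) ys f = trans (cong (∑ ys (f x) +_) (∑-swap xs ys f)) (sym (∑-+ ys (f x) _))

-- The method of conditional expectations: if ∑_x φ e x ≤ s e for each event e, then the expected value of
-- ∑_e w e ∏_i φ e (x_i) over independent uniform x_1, …, x_m is at most ∑_e w e (s e / |Ω|)^m, and choosing
-- the x_i one at a time attains this bound.
conditionalExpectations : ∀ {E Ω : Set} (ω₀ : Ω) (Ωs : List Ω) (es : List E) (φ : E → Ω → ℕ) (s : E → ℕ) →
  (∀ e → ∑ Ωs (φ e) ≤ s e) → ∀ m (w : E → ℕ) →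
  ∃ λ v → length Ωs ^ m * ∑ es (λ e → w e * ∏ v (φ e)) ≤ ∑ es (λ e → w e * s e ^ m)
conditionalExpectations ω₀ Ωs es φ s φ≤s zero w = [] , ≤-reflexive (*-identityˡ _)
conditionalExpectations ω₀ Ωs es φ s φ≤s (suc m) w
  with belowAverage ω₀ Ωs (λ ω → ∑ es (λ e → w e * φ e ω * s e ^ m))
-- The factor of the element just drawn is absorbed into the weights.
... | ω , below with conditionalExpectations ω₀ Ωs es φ s φ≤s m (λ e → w e * φ e ω)
...   | v , bound = ω ∷ v , (begin
  L * L ^ m * ∑ es (λ e → w e * (φ e ω * ∏ v (φ e)))       ≡⟨ *-assoc L (L ^ m) _ ⟩
  L * (L ^ m * ∑ es (λ e → w e * (φ e ω * ∏ v (φ e))))     ≡⟨ cong (λ t → L * (L ^ m * t)) (∑-cong es λ e → *-assoc (w e) _ _) ⟨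
  L * (L ^ m * ∑ es (λ e → w e * φ e ω * ∏ v (φ e)))       ≤⟨ *-monoʳ-≤ L bound ⟩
  L * ∑ es (λ e → w e * φ e ω * s e ^ m)                   ≤⟨ below ⟩
  ∑ Ωs (λ ω → ∑ es (λ e → w e * φ e ω * s e ^ m))          ≡⟨ ∑-swap Ωs es (λ ω e → w e * φ e ω * s e ^ m) ⟩
  ∑ es (λ e → ∑ Ωs (λ ω → w e * φ e ω * s e ^ m))          ≡⟨ ∑-cong es (λ e → ∑-cong Ωs λ ω → rearrange (w e) (φ e ω) (s e ^ m)) ⟩
  ∑ es (λ e → ∑ Ωs (λ ω → w e * s e ^ m * φ e ω))          ≡⟨ ∑-cong es (λ e → ∑-*ˡ Ωs (w e * s e ^ m) (φ e)) ⟩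
  ∑ es (λ e → w e * s e ^ m * ∑ Ωs (φ e))                  ≤⟨ ∑-mono es (λ e → *-monoʳ-≤ (w e * s e ^ m) (φ≤s e)) ⟩
  ∑ es (λ e → w e * s e ^ m * s e)                         ≡⟨ ∑-cong es (λ e → power (w e) (s e) (s e ^ m)) ⟩
  ∑ es (λ e → w e * s e ^ suc m)                           ∎)
  where
  open ≤-Reasoning
  L = length Ωs
  rearrange : ∀ a b c → a * b * c ≡ a * c * b
  rearrange = solve-∀
  power : ∀ a b c → a * c * b ≡ a * (b * c)
  power = solve-∀

-- Counting the sets that cover a pair or lie inside a set

length-cartesianProduct : ∀ {A B : Set} (xs : List A) (ys : List B) →
  length (cartesianProduct xs ys) ≡ length xs * length ys
length-cartesianProduct []       ys = refl
length-cartesianProduct (x ∷ xs) ys = trans (length-++ (map (x ,_) ys))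
  (cong₂ _+_ (length-map (x ,_) ys) (length-cartesianProduct xs ys))

subsets : ∀ N → List (Subset N)
subsets zero    = [] ∷ []
subsets (suc N) = map (true ∷_) (subsets N) ++ᴸ map (false ∷_) (subsets N)

∈-subsets : ∀ {N} (S : Subset N) → S ∈ᴸ subsets N
∈-subsets []          = here refl
∈-subsets (true  ∷ S) = ∈-++⁺ˡ (∈-map⁺ (true ∷_) (∈-subsets S))
∈-subsets (false ∷ S) = ∈-++⁺ʳ (map (true ∷_) (subsets _)) (∈-map⁺ (false ∷_) (∈-subsets S))

∑-subsets-suc : ∀ N (f : Subset (suc N) → ℕ) →
  ∑ (subsets (suc N)) f ≡ ∑ (subsets N) (f ∘ (true ∷_)) + ∑ (subsets N) (f ∘ (false ∷_))
∑-subsets-suc N f = trans (∑-++ (map (true ∷_) (subsets N)) _ f)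
  (cong₂ _+_ (∑-map (true ∷_) (subsets N) f) (∑-map (false ∷_) (subsets N) f))

length-subsets : ∀ N → length (subsets N) ≡ 2 ^ N
length-subsets zero = refl
length-subsets (suc N) = begin
  length (map (true ∷_) (subsets N) ++ᴸ map (false ∷_) (subsets N))
    ≡⟨ length-++ (map (true ∷_) (subsets N)) ⟩
  length (map (true ∷_) (subsets N)) + length (map (false ∷_) (subsets N))
    ≡⟨ cong₂ _+_ (half true) (trans (half false) (sym (+-identityʳ _))) ⟩
  2 ^ N + (2 ^ N + 0) ∎
  where
  open ≡-Reasoning
  half : ∀ b → length (map (b ∷_) (subsets N)) ≡ 2 ^ N
  half b = trans (length-map (b ∷_) (subsets N)) (length-subsets N)

⟦_⟧ : Bool → ℕ
⟦ b ⟧ = if b then 1 else 0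

-- For disjoint `F` and `X`, tests whether `F ⊆ J ⊆ F ∪ X` and `∣ J ∩ X ∣ ≡ ℓ`. The recursion goes
-- element by element to match the count below.
covers : ∀ {N} (F X : Subset N) (ℓ : ℕ) → Subset N → Bool
covers []          []          zero    []          = true
covers []          []          (suc ℓ) []          = false
covers (true  ∷ F) (_     ∷ X) ℓ       (true  ∷ J) = covers F X ℓ J
covers (true  ∷ F) (_     ∷ X) ℓ       (false ∷ J) = false
covers (false ∷ F) (true  ∷ X) zero    (true  ∷ J) = false
covers (false ∷ F) (true  ∷ X) (suc ℓ) (true  ∷ J) = covers F X ℓ J
covers (false ∷ F) (true  ∷ X) ℓ       (false ∷ J) = covers F X ℓ J
covers (false ∷ F) (false ∷ X) ℓ       (true  ∷ J) = false
covers (false ∷ F) (false ∷ X) ℓ       (false ∷ J) = covers F X ℓ J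

covers-sound : ∀ {N} (F X : Subset N) ℓ J → Empty (F ∩ X) → covers F X ℓ J ≡ true →
  ∣ J ∣ ≡ ∣ F ∣ + ℓ × J ⊆ F ∪ X × ∣ J ∩ X ∣ ≡ ℓ
covers-sound [] [] zero [] disj eq = refl , (λ ()) , refl
covers-sound (true ∷ F) (true ∷ X) ℓ J disj eq = contradiction (_ , here) disj
covers-sound (true ∷ F) (false ∷ X) ℓ (true ∷ J) disj eq with covers-sound F X ℓ J (drop-∷-Empty disj) eq
... | size , J⊆ , inter = cong suc size , s⊆s J⊆ , inter
covers-sound (false ∷ F) (true ∷ X) (suc ℓ) (true ∷ J) disj eq with covers-sound F X ℓ J (drop-∷-Empty disj) eq
... | size , J⊆ , inter = trans (cong suc size) (sym (+-suc (∣ F ∣) ℓ)) , s⊆s J⊆ , cong suc inter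
covers-sound (false ∷ F) (true ∷ X) zero (false ∷ J) disj eq with covers-sound F X zero J (drop-∷-Empty disj) eq
... | size , J⊆ , inter = size , out⊆ J⊆ , inter
covers-sound (false ∷ F) (true ∷ X) (suc ℓ) (false ∷ J) disj eq with covers-sound F X (suc ℓ) J (drop-∷-Empty disj) eq
... | size , J⊆ , inter = size , out⊆ J⊆ , inter
covers-sound (false ∷ F) (false ∷ X) ℓ (false ∷ J) disj eq with covers-sound F X ℓ J (drop-∷-Empty disj) eq
... | size , J⊆ , inter = size , out⊆ J⊆ , inter

∑-0 : ∀ {A : Set} (xs : List A) → ∑ xs (λ _ → 0) ≡ 0
∑-0 xs = trans (∑-const xs 0) (*-zeroʳ (length xs))

-- `J` is forced on `F` and outside `F ∪ X`, so only the choice of `ℓ` elements of `X` is free;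
-- deciding on one element of `X` is Pascal's rule.
∑-covers : ∀ {N} (F X : Subset N) ℓ → Empty (F ∩ X) →
  ∑ (subsets N) (⟦_⟧ ∘ covers F X ℓ) ≡ ∣ X ∣ C ℓ
∑-covers [] [] zero disj = refl
∑-covers [] [] (suc ℓ) disj = refl
∑-covers (true ∷ F) (true ∷ X) ℓ disj = contradiction (_ , here) disj
∑-covers {suc N} (true ∷ F) (false ∷ X) ℓ disj =
  trans (∑-subsets-suc N (⟦_⟧ ∘ covers (true ∷ F) (false ∷ X) ℓ))
  (trans (cong₂ _+_ (∑-covers F X ℓ (drop-∷-Empty disj)) (∑-0 (subsets N))) (+-identityʳ _))
∑-covers {suc N} (false ∷ F) (true ∷ X) zero disj =
  trans (∑-subsets-suc N (⟦_⟧ ∘ covers (false ∷ F) (true ∷ X) zero))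
  (cong₂ _+_ (∑-0 (subsets N)) (∑-covers F X zero (drop-∷-Empty disj)))
∑-covers {suc N} (false ∷ F) (true ∷ X) (suc ℓ) disj =
  trans (∑-subsets-suc N (⟦_⟧ ∘ covers (false ∷ F) (true ∷ X) (suc ℓ)))
  (trans (cong₂ _+_ (∑-covers F X ℓ (drop-∷-Empty disj)) (∑-covers F X (suc ℓ) (drop-∷-Empty disj)))
    (nCk+nC[k+1]≡[n+1]C[k+1] (∣ X ∣) ℓ))
∑-covers {suc N} (false ∷ F) (false ∷ X) ℓ disj =
  trans (∑-subsets-suc N (⟦_⟧ ∘ covers (false ∷ F) (false ∷ X) ℓ))
  (cong₂ _+_ (∑-0 (subsets N)) (∑-covers F X ℓ (drop-∷-Empty disj)))

∑-misses : ∀ {N} (F X : Subset N) ℓ → Empty (F ∩ X) →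
  ∑ (subsets N) (⟦_⟧ ∘ not ∘ covers F X ℓ) + ∣ X ∣ C ℓ ≡ 2 ^ N
∑-misses {N} F X ℓ disj = begin
  ∑ (subsets N) (⟦_⟧ ∘ not ∘ covers F X ℓ) + ∣ X ∣ C ℓ
    ≡⟨ cong (∑ (subsets N) (⟦_⟧ ∘ not ∘ covers F X ℓ) +_) (∑-covers F X ℓ disj) ⟨
  ∑ (subsets N) (⟦_⟧ ∘ not ∘ covers F X ℓ) + ∑ (subsets N) (⟦_⟧ ∘ covers F X ℓ)
    ≡⟨ ∑-+ (subsets N) _ _ ⟨
  ∑ (subsets N) (λ J → ⟦ not (covers F X ℓ J) ⟧ + ⟦ covers F X ℓ J ⟧)
    ≡⟨ ∑-cong (subsets N) (λ J → excluded (covers F X ℓ J)) ⟩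
  ∑ (subsets N) (λ _ → 1)
    ≡⟨ ∑-const (subsets N) 1 ⟩
  length (subsets N) * 1
    ≡⟨ *-identityʳ _ ⟩
  length (subsets N)
    ≡⟨ length-subsets N ⟩
  2 ^ N ∎
  where
  open ≡-Reasoning
  excluded : ∀ b → ⟦ not b ⟧ + ⟦ b ⟧ ≡ 1
  excluded true  = refl
  excluded false = refl

-- The `2 ^ ∣ T ∣` subsets of `T` contribute `z` each and all other sets 1. This is one factor of
-- the exponential moment of the number of sampled sets inside `T`.
∑-inside : ∀ {N} (T : Subset N) z → ∑ (subsets N) (λ J → if does (J ⊆? T) then z else 1) ≤ 2 ^ N + z * 2 ^ ∣ T ∣
∑-inside [] z = ≤-trans (≤-reflexive (trans (+-identityʳ z) (sym (*-identityʳ z)))) (n≤1+n _)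
∑-inside {suc N} (true ∷ T) z = ≤-trans (≤-reflexive (∑-subsets-suc N _))
  (≤-trans (+-mono-≤ (∑-inside T z) (∑-inside T z)) (≤-reflexive (double (2 ^ N) z (2 ^ ∣ T ∣))))
  where
  double : ∀ a z b → a + z * b + (a + z * b) ≡ a + (a + 0) + z * (b + (b + 0))
  double = solve-∀
∑-inside {suc N} (false ∷ T) z = ≤-trans (≤-reflexive (∑-subsets-suc N _))
  (≤-trans (+-mono-≤ (≤-reflexive (trans (∑-const (subsets N) 1) (trans (*-identityʳ _) (length-subsets N)))) (∑-inside T z))
    (≤-reflexive (regroup (2 ^ N) (z * 2 ^ ∣ T ∣))))
  where
  regroup : ∀ a b → a + (a + b) ≡ a + (a + 0) + b
  regroup = solve-∀

∏-inside : ∀ {N} (T : Subset N) z v →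
  ∏ v (λ J → if does (J ⊆? T) then z else 1) ≡ z ^ length (filter (_⊆? T) v)
∏-inside T z [] = refl
∏-inside T z (J ∷ v) with does (J ⊆? T)
... | true  = cong (z *_) (∏-inside T z v)
... | false = trans (+-identityʳ _) (∏-inside T z v)

∏≡0 : ∀ {A : Set} (v : List A) f → ∏ v f ≡ 0 → ∃ λ x → x ∈ᴸ v × f x ≡ 0
∏≡0 (x ∷ v) f eq with m*n≡0⇒m≡0∨n≡0 (f x) eq
... | inj₁ fx≡0 = x , here refl , fx≡0
... | inj₂ rest with ∏≡0 v f rest
...   | y , y∈v , fy≡0 = y , there y∈v , fy≡0

-- Existence of sparse covers

∑-guard : ∀ {A P : Set} (xs : List A) (d : Dec P) {f : A → ℕ} {t} →
  (P → ∑ xs f ≤ t) → ∑ xs (λ x → if does d then f x else 0) ≤ t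
∑-guard xs (yes p) ≤t = ≤t p
∑-guard xs (no  _) ≤t = ≤-trans (≤-reflexive (∑-0 xs)) z≤n

-- A union bound over `m` random sets: a pair is bad if no sampled set covers it, and `T` is bad if
-- it contains more than `k` of them, measured by an exponential moment with base `z`. Each of the
-- last two hypotheses limits one kind of event to a quarter of the threshold `z ^ suc k`.
module Existence (N n α ℓ τ k s z m : ℕ) (1<z : 1 < z) (s+C≡2^N : s + n C ℓ ≡ 2 ^ N)
  (fewMisses : 4 * (2 ^ N * 2 ^ N * s ^ m) ≤ (2 ^ N) ^ m)
  (fewInside : 4 * (2 ^ N * (2 ^ N + z * 2 ^ τ) ^ m) ≤ z ^ suc k * (2 ^ N) ^ m) where

  open ≤-Reasoning

  private
    instance
      z≢0 : NonZero z
      z≢0 = >-nonZero (<-trans (s≤s z≤n) 1<z)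

    Event : Set
    Event = (Subset N × Subset N) ⊎ Subset N

    eligible? : ∀ (F X : Subset N) → Dec (∣ X ∣ ≡ n × Empty (F ∩ X))
    eligible? F X = (∣ X ∣ ≟ n) ×-dec ¬? (nonempty? (F ∩ X))

    -- Ineligible pairs and oversized `T` get the factor 0, so that events may range over all pairs
    -- and all sets.
    φ : Event → Subset N → ℕ
    φ (inj₁ (F , X)) J = if does (eligible? F X) then ⟦ not (covers F X ℓ J) ⟧ else 0
    φ (inj₂ T)       J = if does (∣ T ∣ ≤? τ) then (if does (J ⊆? T) then z else 1) else 0

    -- The weights put both kinds on one scale: a missed pair counts `z ^ suc k`, which is what `T`
    -- receives from `k + 1` sampled sets inside it.
    mean weight : Event → ℕ
    mean (inj₁ _) = s
    mean (inj₂ _) = 2 ^ N + z * 2 ^ τ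
    weight (inj₁ _) = z ^ suc k
    weight (inj₂ _) = 1

    φ≤mean : ∀ e → ∑ (subsets N) (φ e) ≤ mean e
    φ≤mean (inj₁ (F , X)) = ∑-guard (subsets N) (eligible? F X) λ (∣X∣≡n , disj) →
      ≤-reflexive (+-cancelʳ-≡ (n C ℓ) _ s (begin-equality
        ∑ (subsets N) (⟦_⟧ ∘ not ∘ covers F X ℓ) + n C ℓ       ≡⟨ cong (λ x → ∑ (subsets N) (⟦_⟧ ∘ not ∘ covers F X ℓ) + x C ℓ) ∣X∣≡n ⟨
        ∑ (subsets N) (⟦_⟧ ∘ not ∘ covers F X ℓ) + ∣ X ∣ C ℓ   ≡⟨ ∑-misses F X ℓ disj ⟩
        2 ^ N                                                  ≡⟨ s+C≡2^N ⟨
        s + n C ℓ                                              ∎))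
    φ≤mean (inj₂ T) = ∑-guard (subsets N) (∣ T ∣ ≤? τ) λ ∣T∣≤τ →
      ≤-trans (∑-inside T z) (+-monoʳ-≤ (2 ^ N) (*-monoʳ-≤ z (^-monoʳ-≤ 2 ∣T∣≤τ)))

    pairs : List (Subset N × Subset N)
    pairs = cartesianProduct (subsets N) (subsets N)

    events : List Event
    events = map inj₁ pairs ++ᴸ map inj₂ (subsets N)

    total : ∑ events (λ e → weight e * mean e ^ m) ≡
      2 ^ N * 2 ^ N * (z ^ suc k * s ^ m) + 2 ^ N * (1 * (2 ^ N + z * 2 ^ τ) ^ m)
    total = trans (∑-++ (map inj₁ pairs) _ _) (cong₂ _+_
      (trans (∑-map inj₁ pairs _) (trans (∑-const pairs _)
        (cong (_* (z ^ suc k * s ^ m)) (trans (length-cartesianProduct (subsets N) (subsets N)) (cong₂ _*_ (length-subsets N) (length-subsets N))))))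
      (trans (∑-map inj₂ (subsets N) _) (trans (∑-const (subsets N) _) (cong (_* (1 * (2 ^ N + z * 2 ^ τ) ^ m)) (length-subsets N)))))

    chosen : ∃ λ v → length (subsets N) ^ m * ∑ events (λ e → weight e * ∏ v (φ e)) ≤ ∑ events (λ e → weight e * mean e ^ m)
    chosen = conditionalExpectations ⊥ (subsets N) events φ mean φ≤mean m weight

    v : List (Subset N)
    v = proj₁ chosen

    A : ℕ
    A = (2 ^ N) ^ m

    W : ℕ
    W = ∑ events (λ e → weight e * ∏ v (φ e))

    W<z^1+k : W < z ^ suc k
    W<z^1+k = *-cancelˡ-< A W (z ^ suc k) (*-cancelˡ-< 4 (A * W) (A * z ^ suc k) (begin-strict
      4 * (A * W)
        ≡⟨ cong (λ L → 4 * (L ^ m * W)) (length-subsets N) ⟨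
      4 * (length (subsets N) ^ m * W)
        ≤⟨ *-monoʳ-≤ 4 (proj₂ chosen) ⟩
      4 * ∑ events (λ e → weight e * mean e ^ m)
        ≡⟨ cong (4 *_) total ⟩
      4 * (2 ^ N * 2 ^ N * (z ^ suc k * s ^ m) + 2 ^ N * (1 * (2 ^ N + z * 2 ^ τ) ^ m))
        ≡⟨ regroup (2 ^ N) (z ^ suc k) (s ^ m) _ ⟩
      z ^ suc k * (4 * (2 ^ N * 2 ^ N * s ^ m)) + 4 * (2 ^ N * (2 ^ N + z * 2 ^ τ) ^ m)
        ≤⟨ +-mono-≤ (*-monoʳ-≤ (z ^ suc k) fewMisses) fewInside ⟩
      z ^ suc k * A + z ^ suc k * A
        ≡⟨ twice (z ^ suc k) A ⟩
      2 * (A * z ^ suc k)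
        <⟨ *-monoˡ-< (A * z ^ suc k) {{m*n≢0 A (z ^ suc k)}} {2} {4} (s≤s (s≤s (s≤s z≤n))) ⟩
      4 * (A * z ^ suc k) ∎))
      where
      instance
        2^N≢0 : NonZero (2 ^ N)
        2^N≢0 = m^n≢0 2 N
        A≢0 : NonZero A
        A≢0 = m^n≢0 (2 ^ N) m
        z^≢0 : NonZero (z ^ suc k)
        z^≢0 = m^n≢0 z (suc k)
      regroup : ∀ a b c d → 4 * (a * a * (b * c) + a * (1 * d)) ≡ b * (4 * (a * a * c)) + 4 * (a * d)
      regroup = solve-∀
      twice : ∀ a b → a * b + a * b ≡ 2 * (b * a)
      twice = solve-∀

    event< : ∀ {e} → e ∈ᴸ events → weight e * ∏ v (φ e) < z ^ suc k
    event< e∈ = ≤-<-trans (∈⇒≤∑ (λ e → weight e * ∏ v (φ e)) e∈) W<z^1+k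

    -- The product, times its weight `z ^ suc k`, stays below that weight. Hence it is 0, and a
    -- vanishing factor exhibits a covering set.
    hit : ∀ F X → ∣ X ∣ ≡ n → Empty (F ∩ X) → ∃ λ J → J ∈ᴸ v × covers F X ℓ J ≡ true
    hit F X ∣X∣≡n disj with ∏≡0 v (φ (inj₁ (F , X))) ∏φ≡0
      where
      w*∏<w = event< (∈-++⁺ˡ (∈-map⁺ inj₁ (∈-cartesianProduct⁺ (∈-subsets F) (∈-subsets X))))
      ∏φ≡0 : ∏ v (φ (inj₁ (F , X))) ≡ 0
      ∏φ≡0 = n<1⇒n≡0 (*-cancelˡ-< (z ^ suc k) _ 1 (<-≤-trans w*∏<w (≤-reflexive (sym (*-identityʳ (z ^ suc k))))))
    ... | J , J∈v , φ≡0 = J , J∈v , covered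
      where
      covered : covers F X ℓ J ≡ true
      covered with covers F X ℓ J | subst (λ b → (if b then ⟦ not (covers F X ℓ J) ⟧ else 0) ≡ 0) (dec-true (eligible? F X) (∣X∣≡n , disj)) φ≡0
      ... | true | _ = refl

    -- More than `k` sampled sets inside `T` would push the product up to `z ^ suc k`.
    few : ∀ T → ∣ T ∣ ≤ τ → length (filter (_⊆? T) v) ≤ k
    few T ∣T∣≤τ = ≮⇒≥ λ k<len → <⇒≱ z^len<z^1+k (^-monoʳ-≤ z k<len)
      where
      ∏φ : ∏ v (φ (inj₂ T)) ≡ z ^ length (filter (_⊆? T) v)
      ∏φ = subst (λ b → ∏ v (λ J → if b then (if does (J ⊆? T) then z else 1) else 0) ≡ z ^ length (filter (_⊆? T) v))
        (sym (dec-true (∣ T ∣ ≤? τ) ∣T∣≤τ)) (∏-inside T z v)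
      z^len<z^1+k : z ^ length (filter (_⊆? T) v) < z ^ suc k
      z^len<z^1+k = subst (_< z ^ suc k) (trans (+-identityʳ _) ∏φ)
        (event< (∈-++⁺ʳ (map inj₁ pairs) (∈-map⁺ inj₂ (∈-subsets T))))

    rightSize? : ∀ (J : Subset N) → Dec (∣ J ∣ ≡ α + ℓ)
    rightSize? J = ∣ J ∣ ≟ α + ℓ

  sparseCover : SparseCover N n α ℓ τ k
  sparseCover = record
    -- Sets covering an eligible pair with `∣ F ∣ ≡ α` have size `α + ℓ`, so the filter keeps them;
    -- sparsity passes to sublists.
    { family = filter rightSize? v
    ; size   = λ J∈ → proj₂ (∈-filter⁻ rightSize? {xs = v} J∈)
    ; cover  = cover
    ; sparse = λ T ∣T∣≤τ → ≤-trans
        (Sublist.length-mono-≤ (Sublist.filter⁺ (_⊆? T) (_⊆? T) (λ { refl J⊆T → J⊆T }) (Sublist.filter-⊆ rightSize? v)))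
        (few T ∣T∣≤τ)
    }
    where
    cover : ∀ F X → ∣ F ∣ ≡ α → ∣ X ∣ ≡ n → (∀ {x} → x ∈ F → x ∉ X) →
      ∃ λ J → J ∈ᴸ filter rightSize? v × J ⊆ F ∪ X × ∣ J ∩ X ∣ ≡ ℓ
    cover F X ∣F∣≡α ∣X∣≡n disj with hit F X ∣X∣≡n empty
      where
      empty : Empty (F ∩ X)
      empty (x , x∈) = disj (proj₁ (x∈p∩q⁻ F X x∈)) (proj₂ (x∈p∩q⁻ F X x∈))
    ... | J , J∈v , cov with covers-sound F X ℓ J (λ (x , x∈) → disj (proj₁ (x∈p∩q⁻ F X x∈)) (proj₂ (x∈p∩q⁻ F X x∈))) cov
    ...   | ∣J∣ , J⊆ , ∣J∩X∣ = J , ∈-filter⁺ rightSize? J∈v (trans ∣J∣ (cong (_+ ℓ) ∣F∣≡α)) , J⊆ , ∣J∩X∣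

-- Estimates

-- The left side consists of the first two terms of the binomial expansion.
bernoulli : ∀ s c q → s ^ suc q + suc q * c * s ^ q ≤ (s + c) ^ suc q
bernoulli s c zero = ≤-reflexive (base s c)
  where
  base : ∀ s c → s * 1 + (c + 0) * 1 ≡ (s + c) * 1
  base = solve-∀
bernoulli s c (suc q) = begin
  s * (s * s ^ q) + suc (suc q) * c * (s * s ^ q)
    ≤⟨ m≤m+n _ _ ⟩
  s * (s * s ^ q) + suc (suc q) * c * (s * s ^ q) + suc q * c * c * s ^ q
    ≡⟨ expand s c q (s ^ q) ⟩
  (s + c) * (s ^ suc q + suc q * c * s ^ q)
    ≤⟨ *-monoʳ-≤ (s + c) (bernoulli s c q) ⟩
  (s + c) * (s + c) ^ suc q ∎
  where
  open ≤-Reasoning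
  expand : ∀ s c q x → s * (s * x) + suc (suc q) * c * (s * x) + suc q * c * c * x ≡
    (s + c) * (s * x + suc q * c * x)
  expand = solve-∀

-- If a trial fails with probability `s / (s + c)`, then `Q ≥ s / c` independent trials all fail
-- with probability at most one half.
halving : ∀ s c Q .{{_ : NonZero Q}} → s ≤ Q * c → 2 * s ^ Q ≤ (s + c) ^ Q
halving s c (suc q) s≤ = begin
  2 * (s * s ^ q)                   ≡⟨ cong (s * s ^ q +_) (+-identityʳ _) ⟩
  s * s ^ q + s * s ^ q             ≤⟨ +-monoʳ-≤ (s * s ^ q) (*-monoˡ-≤ (s ^ q) s≤) ⟩
  s ^ suc q + suc q * c * s ^ q     ≤⟨ bernoulli s c q ⟩
  (s + c) ^ suc q                   ∎
  where open ≤-Reasoning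

-- (1 + x)^i (1 - i x) ≤ 1 for x = d / a and 1 - i x = y / a.
compound : ∀ d i {a y} → a ≡ i * d + y → (a + d) ^ i * y ≤ a * a ^ i
compound d zero {a} {y} refl = ≤-reflexive (trans (*-identityˡ y) (sym (*-identityʳ y)))
compound d (suc i) {a} {y} eq = begin
  (a + d) * (a + d) ^ i * y               ≡⟨ expand a d ((a + d) ^ i) y ⟩
  (a + d) ^ i * (a * y + d * y)           ≤⟨ *-monoʳ-≤ ((a + d) ^ i) (+-monoʳ-≤ (a * y) (*-monoʳ-≤ d y≤a)) ⟩
  (a + d) ^ i * (a * y + d * a)           ≡⟨ collect a d ((a + d) ^ i) y ⟩
  a * ((a + d) ^ i * (d + y))             ≤⟨ *-monoʳ-≤ a (compound d i (trans eq (shift d (i * d) y))) ⟩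
  a * (a * a ^ i)                         ∎
  where
  open ≤-Reasoning
  y≤a : y ≤ a
  y≤a = ≤-trans (m≤n+m y (suc i * d)) (≤-reflexive (sym eq))
  expand : ∀ a d p y → (a + d) * p * y ≡ p * (a * y + d * y)
  expand = solve-∀
  collect : ∀ a d p y → p * (a * y + d * a) ≡ a * (p * (d + y))
  collect = solve-∀
  shift : ∀ d e y → d + e + y ≡ e + (d + y)
  shift = solve-∀

-- Apply `compound` with `y = a - m d`, which is at least half of `a`.
doubling : ∀ a d m .{{_ : NonZero a}} → 2 * (m * d) ≤ a → (a + d) ^ m ≤ 2 * a ^ m
doubling a d m 2md≤a with m≤n⇒∃[o]m+o≡n (≤-trans (m≤n*m (m * d) 2) 2md≤a)
... | y , md+y≡a = *-cancelˡ-≤ a (begin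
  a * (a + d) ^ m               ≤⟨ *-monoˡ-≤ ((a + d) ^ m) a≤2y ⟩
  2 * y * (a + d) ^ m           ≡⟨ rearrange y ((a + d) ^ m) ⟩
  2 * ((a + d) ^ m * y)         ≤⟨ *-monoʳ-≤ 2 (compound d m (sym md+y≡a)) ⟩
  2 * (a * a ^ m)               ≡⟨ swap a (a ^ m) ⟩
  a * (2 * a ^ m)               ∎)
  where
  open ≤-Reasoning
  rearrange : ∀ y p → 2 * y * p ≡ 2 * (p * y)
  rearrange = solve-∀
  swap : ∀ a b → 2 * (a * b) ≡ a * (2 * b)
  swap = solve-∀
  double : ∀ x → 2 * x ≡ x + x
  double = solve-∀
  a≤2y : a ≤ 2 * y
  a≤2y = subst₂ _≤_ md+y≡a (sym (double y)) (+-monoˡ-≤ y (+-cancelˡ-≤ (m * d) _ _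
    (subst₂ _≤_ (double (m * d)) (sym md+y≡a) 2md≤a)))

-- A binomial coefficient of at least average size

∑< : ℕ → (ℕ → ℕ) → ℕ
∑< zero    f = 0
∑< (suc k) f = ∑< k f + f k

aboveAverage : ∀ k f → ∃ λ i → i ≤ k × ∑< (suc k) f ≤ suc k * f i
aboveAverage zero f = 0 , z≤n , ≤-reflexive (sym (+-identityʳ _))
aboveAverage (suc k) f with aboveAverage k f
... | i , i≤k , above with ≤-total (f i) (f (suc k))
...   | inj₁ fi≤ = suc k , ≤-refl , ≤-trans (+-monoˡ-≤ (f (suc k)) (≤-trans above (*-monoʳ-≤ (suc k) fi≤)))
                     (≤-reflexive (+-comm (suc k * f (suc k)) _))
...   | inj₂ ≤fi = i , m≤n⇒m≤1+n i≤k , ≤-trans (+-mono-≤ above ≤fi) (≤-reflexive (+-comm (suc k * f i) _))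

pascalRow : ∀ n k → ∑< (suc k) (suc n C_) ≡ ∑< (suc k) (n C_) + ∑< k (n C_)
pascalRow n zero = refl
pascalRow n (suc k) = trans (cong₂ _+_ (pascalRow n k) (sym (nCk+nC[k+1]≡[n+1]C[k+1] n k)))
  (regroup (∑< k (n C_)) (n C k) (n C suc k))
  where
  regroup : ∀ a b c → a + b + a + (b + c) ≡ a + b + c + (a + b)
  regroup = solve-∀

binomialRow : ∀ n → ∑< (suc n) (n C_) ≡ 2 ^ n
binomialRow zero = refl
binomialRow (suc n) = trans (pascalRow n (suc n)) (cong₂ _+_
  (trans (cong (∑< (suc n) (n C_) +_) (k>n⇒nCk≡0 (n<1+n n))) (trans (+-identityʳ _) (binomialRow n)))
  (trans (binomialRow n) (sym (+-identityʳ _))))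

-- Some coefficient of the row reaches the average `2 ^ n / (n + 1)`, and the symmetry `i ↦ n - i`
-- moves it to the lower half.
largeBinomial : ∀ n → ∃ λ ℓ → 2 * ℓ ≤ n × 2 ^ n ≤ suc n * (n C ℓ)
largeBinomial n with aboveAverage n (n C_)
... | i , i≤n , above with 2 * i ≤? n
...   | yes 2i≤n = i , 2i≤n , subst (_≤ suc n * (n C i)) (binomialRow n) above
...   | no  2i≰n = n ∸ i , 2[n∸i]≤n , subst₂ (λ x y → x ≤ suc n * y) (binomialRow n) (nCk≡nC[n∸k] i≤n) above
  where
  open ≤-Reasoning
  double : ∀ x → 2 * x ≡ x + x
  double = solve-∀
  n∸i≤i : n ∸ i ≤ i
  n∸i≤i = m≤n+o⇒m∸n≤o n i (≤-trans (<⇒≤ (≰⇒> 2i≰n)) (≤-reflexive (double i)))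
  2[n∸i]≤n : 2 * (n ∸ i) ≤ n
  2[n∸i]≤n = begin
    2 * (n ∸ i)           ≡⟨ double (n ∸ i) ⟩
    n ∸ i + (n ∸ i)       ≤⟨ +-monoʳ-≤ (n ∸ i) n∸i≤i ⟩
    n ∸ i + i             ≡⟨ m∸n+n≡m i≤n ⟩
    n                     ∎

^-distribʳ-* : ∀ a b m → (a * b) ^ m ≡ a ^ m * b ^ m
^-distribʳ-* a b zero = refl
^-distribʳ-* a b (suc m) = trans (cong (a * b *_) (^-distribʳ-* a b m)) (regroup a b (a ^ m) (b ^ m))
  where
  regroup : ∀ a b c d → a * b * (c * d) ≡ a * c * (b * d)
  regroup = solve-∀

missCount : ∀ {n N} → n ≤ N → ∀ ℓ → ∃ λ s → s + n C ℓ ≡ 2 ^ N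
missCount {n} {N} n≤N ℓ with subsetOfSize (⊤ {N}) n (subst (n ≤_) (sym (∣⊤∣≡n N)) n≤N)
... | X , _ , refl = _ , (∑-misses ⊥ X ℓ λ (x , x∈) → ∉⊥ (proj₁ (x∈p∩q⁻ ⊥ X x∈)))

-- `2 ^ p` absorbs the polynomial factors and `2 ^ q` is the base of the exponential moment.
-- `exponents` keeps that moment at most 2 for each `T`; the last hypothesis pays for the `2 ^ N`
-- sets `T`.
module Parameters (n κ ℓ k p q : ℕ)
  (central : 2 ^ n ≤ suc n * (n C ℓ))
  (poly≤2^p : (4 * (n + n + κ) + 4) * suc n ≤ 2 ^ p)
  (exponents : p + q + (suc κ + k + κ + ℓ) ≤ n)
  (N+3≤q[1+k] : n + n + κ + 3 ≤ q * suc k) where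

  open ≤-Reasoning

  private
    N τ s z Q R m : ℕ
    N = n + n + κ
    τ = suc κ + k + κ + ℓ
    s = proj₁ (missCount (≤-trans (m≤m+n n n) (m≤m+n (n + n) κ)) ℓ)
    z = 2 ^ q
    -- `Q` is at least `2 ^ N / (n C ℓ)`, so `Q` trials halve the chance of missing a pair; `R`
    -- halvings pay for the `2 ^ N * 2 ^ N` pairs and the factor 4.
    Q = suc n * 2 ^ (n + κ)
    R = 2 + (N + N)
    m = Q * R

    s+C≡2^N : s + n C ℓ ≡ 2 ^ N
    s+C≡2^N = proj₂ (missCount (≤-trans (m≤m+n n n) (m≤m+n (n + n) κ)) ℓ)

    instance
      2^N≢0 : NonZero (2 ^ N)
      2^N≢0 = m^n≢0 2 N
      Q≢0 : NonZero Q
      Q≢0 = m*n≢0 (suc n) (2 ^ (n + κ)) {{_}} {{m^n≢0 2 (n + κ)}}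

    1<z : 1 < z
    1<z = ^-monoʳ-≤ 2 (q≥1 q N+3≤q[1+k])
      where
      q≥1 : ∀ q → N + 3 ≤ q * suc k → 1 ≤ q
      q≥1 (suc q) _ = s≤s z≤n
      q≥1 zero ≤0 = contradiction (≤-trans (m≤n+m 3 N) ≤0) λ ()

    s≤Q*C : s ≤ Q * (n C ℓ)
    s≤Q*C = begin
      s                                   ≤⟨ m≤m+n s (n C ℓ) ⟩
      s + n C ℓ                           ≡⟨ s+C≡2^N ⟩
      2 ^ (n + n + κ)                     ≡⟨ cong (2 ^_) (+-assoc n n κ) ⟩
      2 ^ (n + (n + κ))                   ≡⟨ ^-distribˡ-+-* 2 n (n + κ) ⟩
      2 ^ n * 2 ^ (n + κ)                 ≤⟨ *-monoˡ-≤ (2 ^ (n + κ)) central ⟩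
      suc n * (n C ℓ) * 2 ^ (n + κ)         ≡⟨ swap (suc n) (n C ℓ) (2 ^ (n + κ)) ⟩
      Q * (n C ℓ)                           ∎
      where
      swap : ∀ a b c → a * b * c ≡ a * c * b
      swap = solve-∀

    fewMisses : 4 * (2 ^ N * 2 ^ N * s ^ m) ≤ (2 ^ N) ^ m
    fewMisses = begin
      4 * (2 ^ N * 2 ^ N * s ^ m)           ≡⟨ regroup (2 ^ N * 2 ^ N) (s ^ m) ⟩
      2 * (2 * (2 ^ N * 2 ^ N)) * s ^ m     ≡⟨ cong (λ x → 2 * (2 * x) * s ^ m) (^-distribˡ-+-* 2 N N) ⟨
      2 ^ R * s ^ m                         ≡⟨ cong (2 ^ R *_) (^-*-assoc s Q R) ⟨
      2 ^ R * (s ^ Q) ^ R                   ≡⟨ ^-distribʳ-* 2 (s ^ Q) R ⟨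
      (2 * s ^ Q) ^ R                       ≤⟨ ^-monoˡ-≤ R (halving s (n C ℓ) Q s≤Q*C) ⟩
      ((s + n C ℓ) ^ Q) ^ R                 ≡⟨ cong (λ x → (x ^ Q) ^ R) s+C≡2^N ⟩
      ((2 ^ N) ^ Q) ^ R                     ≡⟨ ^-*-assoc (2 ^ N) Q R ⟩
      (2 ^ N) ^ m                           ∎
      where
      regroup : ∀ a b → 4 * (a * b) ≡ 2 * (2 * a) * b
      regroup = solve-∀

    2md≤2^N : 2 * (m * (z * 2 ^ τ)) ≤ 2 ^ N
    2md≤2^N = begin
      2 * (m * (z * 2 ^ τ))                                   ≡⟨ regroup N (suc n) (2 ^ (n + κ)) z (2 ^ τ) ⟩
      (4 * N + 4) * suc n * z * 2 ^ τ * 2 ^ (n + κ)           ≤⟨ *-monoˡ-≤ (2 ^ (n + κ)) (*-monoˡ-≤ (2 ^ τ) (*-monoˡ-≤ z poly≤2^p)) ⟩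
      2 ^ p * 2 ^ q * 2 ^ τ * 2 ^ (n + κ)                     ≡⟨ cong (λ x → x * 2 ^ τ * 2 ^ (n + κ)) (^-distribˡ-+-* 2 p q) ⟨
      2 ^ (p + q) * 2 ^ τ * 2 ^ (n + κ)                       ≡⟨ cong (_* 2 ^ (n + κ)) (^-distribˡ-+-* 2 (p + q) τ) ⟨
      2 ^ (p + q + τ) * 2 ^ (n + κ)                           ≡⟨ ^-distribˡ-+-* 2 (p + q + τ) (n + κ) ⟨
      2 ^ (p + q + τ + (n + κ))                               ≤⟨ ^-monoʳ-≤ 2 (+-monoˡ-≤ (n + κ) exponents) ⟩
      2 ^ (n + (n + κ))                                       ≡⟨ cong (2 ^_) (+-assoc n n κ) ⟨
      2 ^ N                                                   ∎
      where
      regroup : ∀ N a b c d → 2 * (a * b * (2 + (N + N)) * (c * d)) ≡ (4 * N + 4) * a * c * d * b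
      regroup = solve-∀

    fewInside : 4 * (2 ^ N * (2 ^ N + z * 2 ^ τ) ^ m) ≤ z ^ suc k * (2 ^ N) ^ m
    fewInside = begin
      4 * (2 ^ N * (2 ^ N + z * 2 ^ τ) ^ m)     ≤⟨ *-monoʳ-≤ 4 (*-monoʳ-≤ (2 ^ N) (doubling (2 ^ N) (z * 2 ^ τ) m 2md≤2^N)) ⟩
      4 * (2 ^ N * (2 * (2 ^ N) ^ m))           ≡⟨ regroup (2 ^ N) ((2 ^ N) ^ m) ⟩
      2 ^ N * 8 * (2 ^ N) ^ m                   ≡⟨ cong (_* (2 ^ N) ^ m) (^-distribˡ-+-* 2 N 3) ⟨
      2 ^ (N + 3) * (2 ^ N) ^ m                 ≤⟨ *-monoˡ-≤ ((2 ^ N) ^ m) (^-monoʳ-≤ 2 N+3≤q[1+k]) ⟩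
      2 ^ (q * suc k) * (2 ^ N) ^ m             ≡⟨ cong (_* (2 ^ N) ^ m) (^-*-assoc 2 q (suc k)) ⟨
      z ^ suc k * (2 ^ N) ^ m                   ∎
      where
      regroup : ∀ a b → 4 * (a * (2 * b)) ≡ a * 8 * b
      regroup = solve-∀

  cover : SparseCover N n (suc κ) ℓ τ k
  cover = Existence.sparseCover N n (suc κ) ℓ τ k s z m 1<z s+C≡2^N fewMisses fewInside

  ¬Arrows : ¬ Arrows (rbrChain 4) n N
  ¬Arrows = Colouring₄.¬Arrows₄ cover (begin
    suc κ + k                       ≤⟨ m≤m+n (suc κ + k) κ ⟩
    suc κ + k + κ                   ≤⟨ m≤m+n (suc κ + k + κ) ℓ ⟩
    τ                               ≤⟨ m≤n+m τ (p + q) ⟩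
    p + q + τ                       ≤⟨ exponents ⟩
    n                               ∎)

-- The choice of parameters

2400[1+e+16]≤2^[e+16] : ∀ e → 2400 * suc (e + 16) ≤ 2 ^ (e + 16)
-- Here `40800 = 2400 * 17` and `65536 = 2 ^ 16`.
2400[1+e+16]≤2^[e+16] zero = from-yes (40800 ≤? 65536)
2400[1+e+16]≤2^[e+16] (suc e) = begin
  2400 * suc (suc x)         ≤⟨ *-monoʳ-≤ 2400 (+-monoˡ-≤ (suc x) (s≤s z≤n)) ⟩
  2400 * (suc x + suc x)     ≡⟨ double 2400 (suc x) ⟩
  2 * (2400 * suc x)         ≤⟨ *-monoʳ-≤ 2 (2400[1+e+16]≤2^[e+16] e) ⟩
  2 * 2 ^ x                  ∎
  where
  open ≤-Reasoning
  x = e + 16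
  double : ∀ a x → a * (x + x) ≡ 2 * (a * x)
  double = solve-∀

2400[1+d]≤2^d : ∀ {d} → 450 ≤ d → 2400 * suc d ≤ 2 ^ d
2400[1+d]≤2^d {d} 450≤d = subst (λ d → 2400 * suc d ≤ 2 ^ d) (m∸n+n≡m (≤-trans (from-yes (16 ≤? 450)) 450≤d))
  (2400[1+e+16]≤2^[e+16] (d ∸ 16))

-- With `κ` about 0.24 n and `ℓ ≤ n / 2`, the sum `2 κ + ℓ` is at most 0.98 n. The remaining 0.02 n
-- hold four units `d`: three for `p + q`, one for the constant 450, which is at most `d` because
-- `90000 = 200 * 450`.
module Large (n : ℕ) (90000≤n : 90000 ≤ n) where

  open ≤-Reasoning

  d κ : ℕ
  d = n / 200
  κ = 24 * n / 100

  450≤d : 450 ≤ d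
  450≤d = /-monoˡ-≤ 200 90000≤n

  200d≤n : 200 * d ≤ n
  200d≤n = subst (_≤ n) (*-comm d 200) (m/n*n≤m n 200)

  1+n≤200[1+d] : suc n ≤ 200 * suc d
  1+n≤200[1+d] = begin
    suc n                          ≡⟨ cong suc (m≡m%n+[m/n]*n n 200) ⟩
    suc (n % 200) + d * 200        ≤⟨ +-monoˡ-≤ (d * 200) (m%n<n n 200) ⟩
    200 + d * 200                  ≡⟨ *-comm (suc d) 200 ⟩
    200 * suc d                    ∎

  100κ≤24n : 100 * κ ≤ 24 * n
  100κ≤24n = subst (_≤ 24 * n) (*-comm κ 100) (m/n*n≤m (24 * n) 100)

  κ≤n : κ ≤ n
  κ≤n = *-cancelˡ-≤ 100 (≤-trans 100κ≤24n (*-monoˡ-≤ n (from-yes (24 ≤? 100))))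

  N : ℕ
  N = n + n + κ

  poly≤2^2d : (4 * N + 4) * suc n ≤ 2 ^ (d + d)
  poly≤2^2d = begin
    (4 * N + 4) * suc n               ≤⟨ *-mono-≤ 4N+4≤2^d 1+n≤2^d ⟩
    2 ^ d * 2 ^ d                     ≡⟨ ^-distribˡ-+-* 2 d d ⟨
    2 ^ (d + d)                       ∎
    where
    expand : ∀ n → 4 * (n + n + n) + 12 ≡ 12 * suc n
    expand = solve-∀
    4N+4≤2^d : 4 * N + 4 ≤ 2 ^ d
    4N+4≤2^d = begin
      4 * (n + n + κ) + 4             ≤⟨ +-mono-≤ (*-monoʳ-≤ 4 (+-monoʳ-≤ (n + n) κ≤n)) (from-yes (4 ≤? 12)) ⟩
      4 * (n + n + n) + 12            ≡⟨ expand n ⟩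
      12 * suc n                      ≤⟨ *-monoʳ-≤ 12 1+n≤200[1+d] ⟩
      12 * (200 * suc d)              ≡⟨ *-assoc 12 200 (suc d) ⟨
      2400 * suc d                    ≤⟨ 2400[1+d]≤2^d 450≤d ⟩
      2 ^ d                           ∎
    1+n≤2^d : suc n ≤ 2 ^ d
    1+n≤2^d = ≤-trans 1+n≤200[1+d] (≤-trans (*-monoˡ-≤ (suc d) (from-yes (200 ≤? 2400))) (2400[1+d]≤2^d 450≤d))

  exponents : ∀ {ℓ} → 2 * ℓ ≤ n → d + d + d + (suc κ + 449 + κ + ℓ) ≤ n
  exponents {ℓ} 2ℓ≤n = *-cancelˡ-≤ 100 (begin
    100 * (d + d + d + (suc κ + 449 + κ + ℓ))         ≡⟨ expand d κ ℓ ⟩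
    300 * d + 100 * 450 + (2 * (100 * κ) + 50 * (2 * ℓ))
      ≤⟨ +-mono-≤ (+-monoʳ-≤ (300 * d) (*-monoʳ-≤ 100 450≤d)) (+-mono-≤ (*-monoʳ-≤ 2 100κ≤24n) (*-monoʳ-≤ 50 2ℓ≤n)) ⟩
    300 * d + 100 * d + (2 * (24 * n) + 50 * n)       ≡⟨ collect d n ⟩
    2 * (200 * d) + 98 * n                            ≤⟨ +-monoˡ-≤ (98 * n) (*-monoʳ-≤ 2 200d≤n) ⟩
    2 * n + 98 * n                                    ≡⟨ *-distribʳ-+ n 2 98 ⟨
    100 * n                                           ∎)
    where
    expand : ∀ d κ ℓ → 100 * (d + d + d + (suc κ + 449 + κ + ℓ)) ≡ 300 * d + 100 * 450 + (2 * (100 * κ) + 50 * (2 * ℓ))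
    expand = solve-∀
    collect : ∀ d n → 300 * d + 100 * d + (2 * (24 * n) + 50 * n) ≡ 2 * (200 * d) + 98 * n
    collect = solve-∀

  N+3≤450d : N + 3 ≤ d * 450
  N+3≤450d = *-cancelˡ-≤ 100 (begin
    100 * (n + n + κ + 3)                         ≡⟨ expand n κ ⟩
    200 * n + 100 * κ + 300                       ≤⟨ +-mono-≤ (+-monoʳ-≤ (200 * n) 100κ≤24n) (from-yes (300 ≤? 324)) ⟩
    200 * n + 24 * n + 324                        ≡⟨ collect n ⟩
    224 * suc n + 100                             ≤⟨ +-monoˡ-≤ 100 (*-monoʳ-≤ 224 1+n≤200[1+d]) ⟩
    224 * (200 * suc d) + 100                     ≡⟨ expand₂ d ⟩
    224 * (200 * d) + 100 * 449                   ≤⟨ +-monoʳ-≤ (224 * (200 * d)) (*-monoʳ-≤ 100 (≤-trans (n≤1+n 449) 450≤d)) ⟩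
    224 * (200 * d) + 100 * d                     ≤⟨ +-monoʳ-≤ (224 * (200 * d)) (*-monoˡ-≤ d (from-yes (100 ≤? 200))) ⟩
    224 * (200 * d) + 200 * d                     ≡⟨ collect₂ d ⟩
    100 * (d * 450)                               ∎)
    where
    expand : ∀ n κ → 100 * (n + n + κ + 3) ≡ 200 * n + 100 * κ + 300
    expand = solve-∀
    collect : ∀ n → 200 * n + 24 * n + 324 ≡ 224 * suc n + 100
    collect = solve-∀
    expand₂ : ∀ d → 224 * (200 * suc d) + 100 ≡ 224 * (200 * d) + 100 * 449
    expand₂ = solve-∀
    collect₂ : ∀ d → 224 * (200 * d) + 200 * d ≡ 100 * (d * 450)
    collect₂ = solve-∀

  ¬Arrows : ¬ Arrows (rbrChain 4) n N
  ¬Arrows with largeBinomial n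
  -- With `k = 449` and `q = d`, the product `q * suc k` is about 2.25 n, just above `N + 3`.
  ... | ℓ , 2ℓ≤n , central = Parameters.¬Arrows n κ ℓ 449 (d + d) d central poly≤2^2d (exponents 2ℓ≤n) N+3≤450d

  -- `N` is the integer part of 2.24 n, as `κ` is that of 0.24 n.
  ≤224⇒≤N : ∀ M → 100 * M ≤ 224 * n → M ≤ N
  ≤224⇒≤N M 100M≤224n with ≤-total M (n + n)
  ... | inj₁ M≤2n = ≤-trans M≤2n (m≤m+n (n + n) κ)
  ... | inj₂ 2n≤M with m≤n⇒∃[o]m+o≡n 2n≤M
  ...   | o , refl = +-monoʳ-≤ (n + n) (subst (_≤ κ) (m*n/n≡m o 100) (/-monoˡ-≤ 100 (+-cancelˡ-≤ (200 * n) _ _ (begin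
    200 * n + o * 100            ≡⟨ expand n o ⟩
    100 * (n + n + o)            ≤⟨ 100M≤224n ⟩
    224 * n                      ≡⟨ *-distribʳ-+ n 200 24 ⟩
    200 * n + 24 * n             ∎))))
    where
    expand : ∀ n o → 200 * n + o * 100 ≡ 100 * (n + n + o)
    expand = solve-∀

-- Assembly of the exact values and the asymptotic bounds

theorem5 : ((n : ℕ) → RamseyEq (rbrChain 2) n (2 * n) × RamseyEq (rbrChain 3) n (2 * n))
    × ((t : ℕ) → t ≥ 4 → Σ ℕ λ n₀ → (n : ℕ) → n ≥ n₀ →
    Σ ℕ λ N → RamseyEq (rbrChain t) n N × (224 * n < 100 * N) × (N ≤ (t ∸ 1) * n))
theorem5 = small , large
  where
  small : (n : ℕ) → RamseyEq (rbrChain 2) n (2 * n) × RamseyEq (rbrChain 3) n (2 * n)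
  small n = (Arrows-truncate (n≤1+n 2) arrows₃ , λ M → Arrows-lower₂ 2 n M ≤-refl)
          , (arrows₃ , λ M → Arrows-lower₂ 3 n M (n≤1+n 2))
    where
    arrows₃ : Arrows (rbrChain 3) n (2 * n)
    arrows₃ = AltArrows⇒Arrows (AltArrows-upper 0 n)
  large : (t : ℕ) → t ≥ 4 → Σ ℕ λ n₀ → (n : ℕ) → n ≥ n₀ →
    Σ ℕ λ N → RamseyEq (rbrChain t) n N × (224 * n < 100 * N) × (N ≤ (t ∸ 1) * n)
  large 1 (s≤s ())
  large 2 (s≤s (s≤s ()))
  large t@(suc (suc (suc t′))) 4≤t = 90000 , λ n 90000≤n →
    -- Were the least `N` at most 2.24 n, monotonicity in `N` and truncation to four vertices would
    -- contradict the four-level colouring.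
    let N , ramsey , N≤ = least (arrows? t n) ((t ∸ 1) * n) (AltArrows⇒Arrows (AltArrows-upper t′ n))
    in N , ramsey
       , ≰⇒> (λ 100N≤224n → Large.¬Arrows n 90000≤n
           (Arrows-mono (Large.≤224⇒≤N n 90000≤n N 100N≤224n) (Arrows-truncate 4≤t (proj₁ ramsey))))
       , N≤
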